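{- For integers $n \ge 1$, $$C_n = \binom{2n}{n}\left(\zeta(s) - \sum_{i=1}^{n}\frac{1}{i^{s}} - \sum_{i=n+2}^{\infty}\frac{1}{i^{s}}\right)^{1/s}.$$
   Context: $C_n = \frac{1}{n+1}\binom{2n}{n}$ is the $n$-th Catalan number, and $\binom{2n}{n}$ is the central binomial coefficient. $\zeta$ is the Riemann zeta function, written as the series $\zeta(s)=\sum_{i=1}^{\infty} \frac{1}{i^{s}}$, and $s$ is its complex argument.
   Formalization: For Re s > 1, the identity holds for some value of the multivalued power 1/s, and for the principal value when Im(−s log(n+1)) lies in (−π, π] (so for all real s > 1); with principal powers it fails for other complex s, e.g. n = 1, s = 2+100i. -}

module Defs where

open import Data.Nat as ℕ using (ℕ; zero; suc; _!)
open import Data.Nat.Combinatorics using (_C_)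
import Data.Nat.Properties as ℕₚ
open import Data.Integer as ℤ using (ℤ; +_; -[1+_]; +<+; -<+)
import Data.Integer.Properties as ℤₚ
open import Data.Rational as ℚ
  using (ℚ; mkℚ; 0ℚ; 1ℚ; ½; ∣_∣; *<*; *≤*; Positive; NonNegative; NonZero)
import Data.Rational.Unnormalised as ℚᵘ
import Data.Rational.Unnormalised.Properties as ℚᵘₚ
import Data.Rational.Properties as ℚₚ
open import Data.Rational.Solver using (module +-*-Solver)
open import Data.Product using (Σ; ∃; ∃-syntax; _×_; _,_; proj₁; proj₂)
open import Data.Sum using (inj₁; inj₂)
open import Relation.Binary.PropositionalEquality
  using (_≡_; refl; sym; trans; cong; cong₂; subst; subst₂)

open +-*-Solver

dist : ℚ → ℚ → ℚ
dist p q = ∣ p ℚ.- q ∣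

ℕ→ℚ : ℕ → ℚ
ℕ→ℚ n = + n ℚ./ 1

1/suc : ℕ → ℚ
1/suc n = + 1 ℚ./ suc n

module ℚ-Lemmas where
  open import Data.Rational using (_≤_; _<_)

  half-pos : ∀ {ε} → 0ℚ < ε → 0ℚ < ½ ℚ.* ε
  half-pos {ε} 0<ε =
    subst (_< ½ ℚ.* ε) (ℚₚ.*-zeroʳ ½) (ℚₚ.*-monoʳ-<-pos ½ 0<ε)

  half+half : ∀ ε → ½ ℚ.* ε ℚ.+ ½ ℚ.* ε ≡ ε
  half+half = solve 1 (λ e → con ½ :* e :+ con ½ :* e := e) refl

  *-pos : ∀ {p q} → 0ℚ < p → 0ℚ < q → 0ℚ < p ℚ.* q
  *-pos {p} {q} 0<p 0<q = subst (_< p ℚ.* q) (ℚₚ.*-zeroʳ p)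
    (ℚₚ.*-monoʳ-<-pos p {{ℚ.positive 0<p}} 0<q)

  *-nonneg : ∀ {p q} → 0ℚ ≤ p → 0ℚ ≤ q → 0ℚ ≤ p ℚ.* q
  *-nonneg {p} {q} 0≤p 0≤q = subst (_≤ p ℚ.* q) (ℚₚ.*-zeroʳ p)
    (ℚₚ.*-monoˡ-≤-nonNeg p {{ℚ.nonNegative 0≤p}} 0≤q)

  *-mono-≤ : ∀ {a b c d} → 0ℚ ≤ a → 0ℚ ≤ d → a ≤ b → c ≤ d → a ℚ.* c ≤ b ℚ.* d
  *-mono-≤ {a} {b} {c} {d} 0≤a 0≤d a≤b c≤d = ℚₚ.≤-trans
    (ℚₚ.*-monoˡ-≤-nonNeg a {{ℚ.nonNegative 0≤a}} c≤d)
    (ℚₚ.*-monoʳ-≤-nonNeg d {{ℚ.nonNegative 0≤d}} a≤b)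

  dist-sym : ∀ p q → dist p q ≡ dist q p
  dist-sym p q = trans (sym (ℚₚ.∣-p∣≡∣p∣ (p ℚ.- q)))
    (cong ∣_∣ (solve 2 (λ p q → :- (p :- q) := q :- p) refl p q))

  dist-triangle : ∀ p q r → dist p r ≤ dist p q ℚ.+ dist q r
  dist-triangle p q r = subst (_≤ dist p q ℚ.+ dist q r)
    (cong ∣_∣ (solve 3 (λ p q r → (p :- q) :+ (q :- r) := p :- r) refl p q r))
    (ℚₚ.∣p+q∣≤∣p∣+∣q∣ (p ℚ.- q) (q ℚ.- r))

  dist-self : ∀ p → dist p p ≡ 0ℚ
  dist-self p = cong ∣_∣ (ℚₚ.+-inverseʳ p)

  0≤p≤q⇒∣p∣≤q : ∀ {p q} → 0ℚ ≤ p → p ≤ q → ∣ p ∣ ≤ q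
  0≤p≤q⇒∣p∣≤q 0≤p p≤q = subst (_≤ _) (sym (ℚₚ.0≤p⇒∣p∣≡p 0≤p)) p≤q

  0≤diff : ∀ {p q} → p ≤ q → 0ℚ ≤ q ℚ.- p
  0≤diff {p} {q} p≤q = subst (_≤ q ℚ.- p) (ℚₚ.+-inverseʳ p)
    (ℚₚ.+-monoˡ-≤ (ℚ.- p) p≤q)

  frac-≤ : ∀ a b c d .{{_ : ℕ.NonZero b}} .{{_ : ℕ.NonZero d}} →
           a ℕ.* d ℕ.≤ c ℕ.* b → (+ a ℚ./ b) ≤ (+ c ℚ./ d)
  frac-≤ a b@(suc _) c d@(suc _) h = ℚₚ.toℚᵘ-cancel-≤
    (ℚᵘₚ.≤-trans (ℚᵘₚ.≤-reflexive (ℚₚ.toℚᵘ-fromℚᵘ (+ a ℚᵘ./ b)))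
      (ℚᵘₚ.≤-trans (ℚᵘ.*≤* (subst₂ ℤ._≤_ (ℤₚ.pos-* a d) (ℤₚ.pos-* c b) (ℤ.+≤+ h)))
        (ℚᵘₚ.≤-reflexive (ℚᵘₚ.≃-sym (ℚₚ.toℚᵘ-fromℚᵘ (+ c ℚᵘ./ d))))))

  frac-pos : ∀ a b .{{_ : ℕ.NonZero b}} → 0ℚ < (+ suc a ℚ./ b)
  frac-pos a b = ℚₚ.positive⁻¹ _ {{ℚₚ.normalize-pos (suc a) b}}

  frac-nonneg : ∀ a b .{{_ : ℕ.NonZero b}} → 0ℚ ≤ (+ a ℚ./ b)
  frac-nonneg a b = ℚₚ.nonNegative⁻¹ _ {{ℚₚ.normalize-nonNeg a b}}

  frac-* : ∀ a b c d .{{_ : ℕ.NonZero b}} .{{_ : ℕ.NonZero d}} .{{_ : ℕ.NonZero (b ℕ.* d)}} →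
           (+ a ℚ./ b) ℚ.* (+ c ℚ./ d) ≡ + (a ℕ.* c) ℚ./ (b ℕ.* d)
  frac-* a b@(suc _) c d@(suc _) = ℚₚ.toℚᵘ-injective
    (ℚᵘₚ.≃-trans (ℚₚ.toℚᵘ-homo-* (+ a ℚ./ b) (+ c ℚ./ d))
      (ℚᵘₚ.≃-trans
        (ℚᵘₚ.*-cong (ℚₚ.toℚᵘ-fromℚᵘ (+ a ℚᵘ./ b)) (ℚₚ.toℚᵘ-fromℚᵘ (+ c ℚᵘ./ d)))
        (ℚᵘₚ.≃-trans
          (ℚᵘ.*≡* (cong (ℤ._* + (b ℕ.* d)) (sym (ℤₚ.pos-* a c))))
          (ℚᵘₚ.≃-sym (ℚₚ.toℚᵘ-fromℚᵘ (+ (a ℕ.* c) ℚᵘ./ (b ℕ.* d)))))))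

  archimedean : ∀ p → ∃[ k ] p ≤ ℕ→ℚ k
  archimedean p@(mkℚ -[1+ a ] d _) = 0 , *≤* (ℤₚ.≤-trans (ℤ.-≤+) (ℤₚ.≤-reflexive (sym (ℤₚ.*-zeroˡ (+ suc d)))))
  archimedean p@(mkℚ (+ a) d _) = a , subst (_≤ ℕ→ℚ a) (ℚₚ.↥p/↧p≡p p)
    (frac-≤ a (suc d) a 1
      (ℕₚ.≤-trans (ℕₚ.≤-reflexive (ℕₚ.*-identityʳ a)) (ℕₚ.m≤m*n a (suc d))))

  small : ∀ p {ε} → 0ℚ < ε → ∃[ k ] p ≤ ε ℚ.* ℕ→ℚ (suc k)
  small p {ε} 0<ε with archimedean (p ℚ.* ℚ.1/ ε)
    where instance _ = ℚ.>-nonZero 0<ε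
  ... | k , h = k , (begin
      p                        ≡⟨ sym (ℚₚ.*-identityʳ p) ⟩
      p ℚ.* 1ℚ                 ≡⟨ cong (p ℚ.*_) (sym (ℚₚ.*-inverseˡ ε)) ⟩
      p ℚ.* (ℚ.1/ ε ℚ.* ε)     ≡⟨ sym (ℚₚ.*-assoc p (ℚ.1/ ε) ε) ⟩
      (p ℚ.* ℚ.1/ ε) ℚ.* ε     ≤⟨ ℚₚ.*-monoʳ-≤-nonNeg ε {{ℚ.nonNegative (ℚₚ.<⇒≤ 0<ε)}} h ⟩
      ℕ→ℚ k ℚ.* ε              ≤⟨ ℚₚ.*-monoʳ-≤-nonNeg ε {{ℚ.nonNegative (ℚₚ.<⇒≤ 0<ε)}} k≤1+k ⟩
      ℕ→ℚ (suc k) ℚ.* ε        ≡⟨ ℚₚ.*-comm (ℕ→ℚ (suc k)) ε ⟩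
      ε ℚ.* ℕ→ℚ (suc k)        ∎)
    where
    open ℚₚ.≤-Reasoning
    instance _ = ℚ.>-nonZero 0<ε
    k≤1+k : ℕ→ℚ k ≤ ℕ→ℚ (suc k)
    k≤1+k = frac-≤ k 1 (suc k) 1 (ℕₚ.*-monoˡ-≤ 1 (ℕₚ.n≤1+n k))

open ℚ-Lemmas

IsCauchy : (ℕ → ℚ) → Set
IsCauchy x = ∀ ε → 0ℚ ℚ.< ε →
  ∃[ N ] ∀ m n → N ℕ.≤ m → N ℕ.≤ n → dist (x m) (x n) ℚ.≤ ε

record ℝ : Set where
  constructor mkℝ
  field
    seq    : ℕ → ℚ
    cauchy : IsCauchy seq
open ℝ public

infix 4 _≃ᴿ_ _≤ᴿ_ _<ᴿ_

_≃ᴿ_ : ℝ → ℝ → Set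
x ≃ᴿ y = ∀ ε → 0ℚ ℚ.< ε →
  ∃[ N ] ∀ n → N ℕ.≤ n → dist (seq x n) (seq y n) ℚ.≤ ε

_≤ᴿ_ : ℝ → ℝ → Set
x ≤ᴿ y = ∀ ε → 0ℚ ℚ.< ε →
  ∃[ N ] ∀ n → N ℕ.≤ n → seq x n ℚ.≤ seq y n ℚ.+ ε

_<ᴿ_ : ℝ → ℝ → Set
x <ᴿ y = ∃[ δ ] 0ℚ ℚ.< δ ×
  ∃[ N ] ∀ n → N ℕ.≤ n → seq x n ℚ.+ δ ℚ.≤ seq y n

module Cauchy-Lemmas where
  open import Data.Rational using (_≤_; _<_)
  open ℚₚ.≤-Reasoning

  anchored : ∀ {x : ℕ → ℚ} →
    (∀ ε → 0ℚ < ε → ∃[ K ] ∀ k → K ℕ.≤ k → dist (x k) (x K) ≤ ε) → IsCauchy x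
  anchored {x} h ε 0<ε with h (½ ℚ.* ε) (half-pos 0<ε)
  ... | K , hK = K , λ m n K≤m K≤n → begin
    dist (x m) (x n)                        ≤⟨ dist-triangle (x m) (x K) (x n) ⟩
    dist (x m) (x K) ℚ.+ dist (x K) (x n)   ≡⟨ cong (dist (x m) (x K) ℚ.+_) (dist-sym (x K) (x n)) ⟩
    dist (x m) (x K) ℚ.+ dist (x n) (x K)   ≤⟨ ℚₚ.+-mono-≤ (hK m K≤m) (hK n K≤n) ⟩
    ½ ℚ.* ε ℚ.+ ½ ℚ.* ε                     ≡⟨ half+half ε ⟩
    ε                                       ∎

  const-cauchy : ∀ q → IsCauchy (λ _ → q)
  const-cauchy q ε 0<ε = 0 , λ _ _ _ _ →
    ℚₚ.≤-trans (ℚₚ.≤-reflexive (dist-self q)) (ℚₚ.<⇒≤ 0<ε)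

  +-cauchy : ∀ {x y} → IsCauchy x → IsCauchy y → IsCauchy (λ n → x n ℚ.+ y n)
  +-cauchy {x} {y} cx cy ε 0<ε with cx (½ ℚ.* ε) (half-pos 0<ε) | cy (½ ℚ.* ε) (half-pos 0<ε)
  ... | N , hN | M , hM = N ℕ.⊔ M , λ m n p q → begin
    dist (x m ℚ.+ y m) (x n ℚ.+ y n)
      ≡⟨ cong ∣_∣ (solve 4 (λ a b c d → (a :+ b) :- (c :+ d) := (a :- c) :+ (b :- d))
                     refl (x m) (y m) (x n) (y n)) ⟩
    ∣ (x m ℚ.- x n) ℚ.+ (y m ℚ.- y n) ∣
      ≤⟨ ℚₚ.∣p+q∣≤∣p∣+∣q∣ (x m ℚ.- x n) (y m ℚ.- y n) ⟩
    dist (x m) (x n) ℚ.+ dist (y m) (y n)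
      ≤⟨ ℚₚ.+-mono-≤ (hN m n (ℕₚ.m⊔n≤o⇒m≤o N M p) (ℕₚ.m⊔n≤o⇒m≤o N M q))
                     (hM m n (ℕₚ.m⊔n≤o⇒n≤o N M p) (ℕₚ.m⊔n≤o⇒n≤o N M q)) ⟩
    ½ ℚ.* ε ℚ.+ ½ ℚ.* ε
      ≡⟨ half+half ε ⟩
    ε ∎

  neg-cauchy : ∀ {x} → IsCauchy x → IsCauchy (λ n → ℚ.- x n)
  neg-cauchy {x} cx ε 0<ε with cx ε 0<ε
  ... | N , hN = N , λ m n p q → subst (_≤ ε)
    (trans (dist-sym (x m) (x n)) (cong ∣_∣
      (solve 2 (λ a b → b :- a := (:- a) :- (:- b)) refl (x m) (x n))))
    (hN m n p q)

  prefix-bound : ∀ (x : ℕ → ℚ) N → ∃[ B ] ∀ n → n ℕ.< N → ∣ x n ∣ ≤ B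
  prefix-bound x zero = 0ℚ , λ _ ()
  prefix-bound x (suc N) with prefix-bound x N
  ... | B , hB = B ℚ.⊔ ∣ x N ∣ , go
    where
    go : ∀ n → n ℕ.< suc N → ∣ x n ∣ ≤ B ℚ.⊔ ∣ x N ∣
    go n (ℕ.s≤s n≤N) with ℕₚ.m≤n⇒m<n∨m≡n n≤N
    ... | inj₁ n<N  = ℚₚ.≤-trans (hB n n<N) (ℚₚ.p≤p⊔q B ∣ x N ∣)
    ... | inj₂ refl = ℚₚ.p≤q⊔p B ∣ x N ∣

  bounded : ∀ {x} → IsCauchy x → ∃[ B ] 0ℚ < B × (∀ n → ∣ x n ∣ ≤ B)
  bounded {x} cx with cx 1ℚ (ℚₚ.positive⁻¹ 1ℚ)
  ... | N , hN with prefix-bound x N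
  ...   | B , hB = C , 0<C , go
    where
    D = 1ℚ ℚ.+ ∣ x N ∣
    C = D ℚ.⊔ B
    0<C : 0ℚ < C
    0<C = begin-strict
      0ℚ              <⟨ ℚₚ.positive⁻¹ 1ℚ ⟩
      1ℚ              ≡⟨ sym (ℚₚ.+-identityʳ 1ℚ) ⟩
      1ℚ ℚ.+ 0ℚ       ≤⟨ ℚₚ.+-monoʳ-≤ 1ℚ (ℚₚ.0≤∣p∣ (x N)) ⟩
      D               ≤⟨ ℚₚ.p≤p⊔q D B ⟩
      C               ∎
    go : ∀ n → ∣ x n ∣ ≤ C
    go n with ℕₚ.<-≤-connex n N
    ... | inj₁ n<N = ℚₚ.≤-trans (hB n n<N) (ℚₚ.p≤q⊔p D B)
    ... | inj₂ N≤n = begin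
      ∣ x n ∣                           ≡⟨ cong ∣_∣ (solve 2 (λ a b → a := (a :- b) :+ b) refl (x n) (x N)) ⟩
      ∣ (x n ℚ.- x N) ℚ.+ x N ∣         ≤⟨ ℚₚ.∣p+q∣≤∣p∣+∣q∣ (x n ℚ.- x N) (x N) ⟩
      dist (x n) (x N) ℚ.+ ∣ x N ∣      ≤⟨ ℚₚ.+-monoˡ-≤ ∣ x N ∣ (hN n N N≤n ℕₚ.≤-refl) ⟩
      D                                 ≤⟨ ℚₚ.p≤p⊔q D B ⟩
      C                                 ∎

  *-cauchy : ∀ {x y} → IsCauchy x → IsCauchy y → IsCauchy (λ n → x n ℚ.* y n)
  *-cauchy {x} {y} cx cy ε 0<ε with bounded {x} cx | bounded {y} cy
  ... | B , 0<B , hB | C , 0<C , hC = N ℕ.⊔ M , λ m n p q → begin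
      dist (x m ℚ.* y m) (x n ℚ.* y n)
        ≡⟨ cong ∣_∣ (solve 4 (λ a b c d → (a :* b) :- (c :* d) := a :* (b :- d) :+ (a :- c) :* d)
                       refl (x m) (y m) (x n) (y n)) ⟩
      ∣ x m ℚ.* (y m ℚ.- y n) ℚ.+ (x m ℚ.- x n) ℚ.* y n ∣
        ≤⟨ ℚₚ.∣p+q∣≤∣p∣+∣q∣ (x m ℚ.* (y m ℚ.- y n)) ((x m ℚ.- x n) ℚ.* y n) ⟩
      ∣ x m ℚ.* (y m ℚ.- y n) ∣ ℚ.+ ∣ (x m ℚ.- x n) ℚ.* y n ∣
        ≡⟨ cong₂ ℚ._+_ (ℚₚ.∣p*q∣≡∣p∣*∣q∣ (x m) (y m ℚ.- y n)) (ℚₚ.∣p*q∣≡∣p∣*∣q∣ (x m ℚ.- x n) (y n)) ⟩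
      ∣ x m ∣ ℚ.* dist (y m) (y n) ℚ.+ dist (x m) (x n) ℚ.* ∣ y n ∣
        ≤⟨ ℚₚ.+-mono-≤
             (*-mono-≤ (ℚₚ.0≤∣p∣ (x m)) (ℚₚ.<⇒≤ (over-pos 0<B)) (hB m)
               (proj₂ cy' m n (ℕₚ.m⊔n≤o⇒n≤o N M p) (ℕₚ.m⊔n≤o⇒n≤o N M q)))
             (*-mono-≤ (ℚₚ.0≤∣p∣ (x m ℚ.- x n)) (ℚₚ.<⇒≤ 0<C)
               (proj₂ cx' m n (ℕₚ.m⊔n≤o⇒m≤o N M p) (ℕₚ.m⊔n≤o⇒m≤o N M q)) (hC n)) ⟩
      B ℚ.* over 0<B ℚ.+ over 0<C ℚ.* C
        ≡⟨ cong₂ ℚ._+_ (trans (ℚₚ.*-comm B (over 0<B)) (over-* 0<B)) (over-* 0<C) ⟩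
      ½ ℚ.* ε ℚ.+ ½ ℚ.* ε
        ≡⟨ half+half ε ⟩
      ε ∎
    where
    over : ∀ {b} → 0ℚ < b → ℚ
    over {b} 0<b = (½ ℚ.* ε) ℚ.* (ℚ.1/ b) {{ℚ.>-nonZero 0<b}}
    over-pos : ∀ {b} (0<b : 0ℚ < b) → 0ℚ < over 0<b
    over-pos {b} 0<b = *-pos (half-pos 0<ε)
      (ℚₚ.positive⁻¹ _ {{ℚₚ.1/pos⇒pos b {{ℚ.positive 0<b}}}})
    over-* : ∀ {b} (0<b : 0ℚ < b) → over 0<b ℚ.* b ≡ ½ ℚ.* ε
    over-* {b} 0<b = trans (ℚₚ.*-assoc (½ ℚ.* ε) _ b)
      (trans (cong (½ ℚ.* ε ℚ.*_) (ℚₚ.*-inverseˡ b {{ℚ.>-nonZero 0<b}})) (ℚₚ.*-identityʳ (½ ℚ.* ε)))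
    cx' = cx (over 0<C) (over-pos 0<C)
    cy' = cy (over 0<B) (over-pos 0<B)
    N = proj₁ cx'
    M = proj₁ cy'

  ⊔-pos : ∀ {c} → 0ℚ < c → ∀ q → 0ℚ < c ℚ.⊔ q
  ⊔-pos {c} 0<c q = ℚₚ.<-≤-trans 0<c (ℚₚ.p≤p⊔q c q)

  -- 1/(c ⊔ q): agrees with 1/q once q ≥ c > 0.
  recip⊔ : ∀ {c} → 0ℚ < c → ℚ → ℚ
  recip⊔ {c} 0<c q = (ℚ.1/ (c ℚ.⊔ q)) {{ℚ.>-nonZero (⊔-pos 0<c q)}}

  recip-cauchy : ∀ {x c} (0<c : 0ℚ < c) N → (∀ n → N ℕ.≤ n → c ≤ x n) →
                 IsCauchy x → IsCauchy (λ n → recip⊔ 0<c (x n))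
  recip-cauchy {x} {c} 0<c N hN cx ε 0<ε =
    N ℕ.⊔ M , λ m n p q → bound m n (ℕₚ.m⊔n≤o⇒m≤o N M p) (ℕₚ.m⊔n≤o⇒m≤o N M q)
                              (hM m n (ℕₚ.m⊔n≤o⇒n≤o N M p) (ℕₚ.m⊔n≤o⇒n≤o N M q))
    where
    δ = ε ℚ.* (c ℚ.* c)
    M = proj₁ (cx δ (*-pos 0<ε (*-pos 0<c 0<c)))
    hM = proj₂ (cx δ (*-pos 0<ε (*-pos 0<c 0<c)))
    bound : ∀ m n → N ℕ.≤ m → N ℕ.≤ n → dist (x m) (x n) ≤ δ →
            dist (recip⊔ 0<c (x m)) (recip⊔ 0<c (x n)) ≤ ε
    bound m n N≤m N≤n h = ℚₚ.*-cancelʳ-≤-pos (c ℚ.* c) {{ℚ.positive (*-pos 0<c 0<c)}} (begin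
        ∣ u ℚ.- v ∣ ℚ.* (c ℚ.* c)
          ≤⟨ *-mono-≤ (ℚₚ.0≤∣p∣ (u ℚ.- v)) (*-nonneg (ℚₚ.<⇒≤ 0<a) (ℚₚ.<⇒≤ 0<b)) ℚₚ.≤-refl
               (*-mono-≤ (ℚₚ.<⇒≤ 0<c) (ℚₚ.<⇒≤ 0<b) (ℚₚ.p≤p⊔q c (x m)) (ℚₚ.p≤p⊔q c (x n))) ⟩
        ∣ u ℚ.- v ∣ ℚ.* (a ℚ.* b)
          ≡⟨ cong (∣ u ℚ.- v ∣ ℚ.*_) (sym (ℚₚ.0≤p⇒∣p∣≡p (*-nonneg (ℚₚ.<⇒≤ 0<a) (ℚₚ.<⇒≤ 0<b)))) ⟩
        ∣ u ℚ.- v ∣ ℚ.* ∣ a ℚ.* b ∣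
          ≡⟨ sym (ℚₚ.∣p*q∣≡∣p∣*∣q∣ (u ℚ.- v) (a ℚ.* b)) ⟩
        ∣ (u ℚ.- v) ℚ.* (a ℚ.* b) ∣
          ≡⟨ cong ∣_∣ (solve 4 (λ u v a b → (u :- v) :* (a :* b) := (u :* a) :* b :- (v :* b) :* a)
                         refl u v a b) ⟩
        ∣ (u ℚ.* a) ℚ.* b ℚ.- (v ℚ.* b) ℚ.* a ∣
          ≡⟨ cong₂ (λ s t → ∣ s ℚ.* b ℚ.- t ℚ.* a ∣) ua vb ⟩
        ∣ 1ℚ ℚ.* b ℚ.- 1ℚ ℚ.* a ∣
          ≡⟨ cong₂ (λ s t → ∣ s ℚ.- t ∣)
               (trans (ℚₚ.*-identityˡ b) (ℚₚ.p≤q⇒p⊔q≡q (hN n N≤n)))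
               (trans (ℚₚ.*-identityˡ a) (ℚₚ.p≤q⇒p⊔q≡q (hN m N≤m))) ⟩
        dist (x n) (x m)  ≡⟨ dist-sym (x n) (x m) ⟩
        dist (x m) (x n)  ≤⟨ h ⟩
        δ                 ∎)
      where
      a = c ℚ.⊔ x m
      b = c ℚ.⊔ x n
      0<a = ⊔-pos 0<c (x m)
      0<b = ⊔-pos 0<c (x n)
      u = recip⊔ 0<c (x m)
      v = recip⊔ 0<c (x n)
      ua : u ℚ.* a ≡ 1ℚ
      ua = ℚₚ.*-inverseˡ a {{ℚ.>-nonZero 0<a}}
      vb : v ℚ.* b ≡ 1ℚ
      vb = ℚₚ.*-inverseˡ b {{ℚ.>-nonZero 0<b}}

  diagonal-cauchy : (P : ℕ → ℝ) →
    (∀ ε → 0ℚ < ε → ∃[ K ] ∀ k → K ℕ.≤ k → ∀ n → dist (seq (P k) n) (seq (P K) n) ≤ ε) →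
    IsCauchy (λ n → seq (P n) n)
  diagonal-cauchy P h ε 0<ε with h (½ ℚ.* (½ ℚ.* ε)) (half-pos (half-pos 0<ε))
  ... | K , hK with cauchy (P K) (½ ℚ.* ε) (half-pos 0<ε)
  ...   | N , hN = K ℕ.⊔ N , λ m n p q → begin
      dist (seq (P m) m) (seq (P n) n)
        ≤⟨ dist-triangle (seq (P m) m) (seq (P K) m) (seq (P n) n) ⟩
      dist (seq (P m) m) (seq (P K) m) ℚ.+ dist (seq (P K) m) (seq (P n) n)
        ≤⟨ ℚₚ.+-mono-≤ (hK m (ℕₚ.m⊔n≤o⇒m≤o K N p) m)
             (dist-triangle (seq (P K) m) (seq (P K) n) (seq (P n) n)) ⟩
      η ℚ.+ (dist (seq (P K) m) (seq (P K) n) ℚ.+ dist (seq (P K) n) (seq (P n) n))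
        ≤⟨ ℚₚ.+-monoʳ-≤ η (ℚₚ.+-mono-≤
             (hN m n (ℕₚ.m⊔n≤o⇒n≤o K N p) (ℕₚ.m⊔n≤o⇒n≤o K N q))
             (ℚₚ.≤-trans (ℚₚ.≤-reflexive (dist-sym (seq (P K) n) (seq (P n) n)))
                         (hK n (ℕₚ.m⊔n≤o⇒m≤o K N q) n))) ⟩
      η ℚ.+ (½ ℚ.* ε ℚ.+ η)
        ≡⟨ solve 1 (λ e → con ½ :* (con ½ :* e) :+ (con ½ :* e :+ con ½ :* (con ½ :* e)) := e) refl ε ⟩
      ε ∎
    where η = ½ ℚ.* (½ ℚ.* ε)

open Cauchy-Lemmas

infix  8 -ᴿ_
infixl 7 _*ᴿ_
infixl 6 _+ᴿ_ _-ᴿ_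

ℚ→ℝ : ℚ → ℝ
ℚ→ℝ q = mkℝ (λ _ → q) (const-cauchy q)

0ᴿ 1ᴿ : ℝ
0ᴿ = ℚ→ℝ 0ℚ
1ᴿ = ℚ→ℝ 1ℚ

_+ᴿ_ _*ᴿ_ : ℝ → ℝ → ℝ
x +ᴿ y = mkℝ (λ n → seq x n ℚ.+ seq y n) (+-cauchy {seq x} {seq y} (cauchy x) (cauchy y))
x *ᴿ y = mkℝ (λ n → seq x n ℚ.* seq y n) (*-cauchy {seq x} {seq y} (cauchy x) (cauchy y))

-ᴿ_ : ℝ → ℝ
-ᴿ x = mkℝ (λ n → ℚ.- seq x n) (neg-cauchy {seq x} (cauchy x))

_-ᴿ_ : ℝ → ℝ → ℝ
x -ᴿ y = x +ᴿ (-ᴿ y)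

recipᴿ : (x : ℝ) → 0ᴿ <ᴿ x → ℝ
recipᴿ x (c , 0<c , N , h) = mkℝ (λ n → recip⊔ 0<c (seq x n))
  (recip-cauchy {seq x} 0<c N
    (λ n N≤n → subst (ℚ._≤ seq x n) (ℚₚ.+-identityˡ c) (h n N≤n)) (cauchy x))

_⟶ᴿ_ : (ℕ → ℝ) → ℝ → Set
x ⟶ᴿ y = ∀ ε → 0ℚ ℚ.< ε → ∃[ K ] ∀ k → K ℕ.≤ k →
  (x k -ᴿ y) ≤ᴿ ℚ→ℝ ε × (y -ᴿ x k) ≤ᴿ ℚ→ℝ ε

-- π = 4(1 − 1/3 + 1/5 − 1/7 + …), with consecutive terms paired.
leibnizPair : ℕ → ℚ
leibnizPair k = (+ 4 ℚ./ suc (4 ℕ.* k)) ℚ.- (+ 4 ℚ./ (3 ℕ.+ 4 ℕ.* k))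

leibnizSum : ℕ → ℚ
leibnizSum zero    = 0ℚ
leibnizSum (suc k) = leibnizSum k ℚ.+ leibnizPair k

module Leibniz-Lemmas where
  open import Data.Rational using (_≤_; _<_)
  open ℚₚ.≤-Reasoning

  gap : ℕ → ℚ
  gap k = + 4 ℚ./ suc (4 ℕ.* k)

  gap-suc : ∀ k → gap (suc k) ≤ + 4 ℚ./ (3 ℕ.+ 4 ℕ.* k)
  gap-suc k = frac-≤ 4 (suc (4 ℕ.* suc k)) 4 (3 ℕ.+ 4 ℕ.* k)
    (ℕₚ.*-monoʳ-≤ 4 (ℕₚ.≤-trans
      (ℕₚ.+-monoˡ-≤ (4 ℕ.* k) (ℕₚ.m≤n+m 3 2))
      (ℕₚ.≤-reflexive (cong suc (sym (ℕₚ.*-suc 4 k))))))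

  gap-mono : ∀ k → (+ 4 ℚ./ (3 ℕ.+ 4 ℕ.* k)) ≤ gap k
  gap-mono k = frac-≤ 4 (3 ℕ.+ 4 ℕ.* k) 4 (suc (4 ℕ.* k))
    (ℕₚ.*-monoʳ-≤ 4 (ℕₚ.m≤n+m (suc (4 ℕ.* k)) 2))

  gap-small : ∀ k → gap k ℚ.* ℕ→ℚ (suc k) ≤ ℕ→ℚ 4
  gap-small k = begin
    gap k ℚ.* ℕ→ℚ (suc k)                            ≡⟨ frac-* 4 (suc (4 ℕ.* k)) (suc k) 1 ⟩
    + (4 ℕ.* suc k) ℚ./ (suc (4 ℕ.* k) ℕ.* 1)
      ≤⟨ frac-≤ (4 ℕ.* suc k) (suc (4 ℕ.* k) ℕ.* 1) 4 1
           (subst₂ ℕ._≤_ (sym (ℕₚ.*-identityʳ (4 ℕ.* suc k)))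
             (cong (4 ℕ.*_) (sym (ℕₚ.*-identityʳ (suc (4 ℕ.* k)))))
             (ℕₚ.*-monoʳ-≤ 4 (ℕ.s≤s (ℕₚ.m≤n*m k 4)))) ⟩
    ℕ→ℚ 4 ∎

  lower : ∀ K j → leibnizSum K ≤ leibnizSum (j ℕ.+ K)
  lower K zero    = ℚₚ.≤-refl
  lower K (suc j) = begin
    leibnizSum K                              ≤⟨ lower K j ⟩
    leibnizSum (j ℕ.+ K)                      ≡⟨ sym (ℚₚ.+-identityʳ _) ⟩
    leibnizSum (j ℕ.+ K) ℚ.+ 0ℚ               ≤⟨ ℚₚ.+-monoʳ-≤ (leibnizSum (j ℕ.+ K)) (0≤diff (gap-mono (j ℕ.+ K))) ⟩
    leibnizSum (suc j ℕ.+ K)                  ∎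

  upper : ∀ K j → leibnizSum (j ℕ.+ K) ℚ.+ gap (j ℕ.+ K) ≤ leibnizSum K ℚ.+ gap K
  upper K zero    = ℚₚ.≤-refl
  upper K (suc j) = begin
    (S ℚ.+ (g ℚ.- h)) ℚ.+ gap (suc i)  ≤⟨ ℚₚ.+-monoʳ-≤ (S ℚ.+ (g ℚ.- h)) (gap-suc i) ⟩
    (S ℚ.+ (g ℚ.- h)) ℚ.+ h            ≡⟨ solve 3 (λ S g h → (S :+ (g :- h)) :+ h := S :+ g) refl S g h ⟩
    S ℚ.+ g                            ≤⟨ upper K j ⟩
    leibnizSum K ℚ.+ gap K             ∎
    where
    i = j ℕ.+ K
    S = leibnizSum i
    g = gap i
    h = + 4 ℚ./ (3 ℕ.+ 4 ℕ.* i)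

  gap≤ : ∀ K {ε} → ℕ→ℚ 4 ℚ.≤ ε ℚ.* ℕ→ℚ (suc K) → gap K ≤ ε
  gap≤ K {ε} h = ℚₚ.*-cancelʳ-≤-pos (ℕ→ℚ (suc K)) {{ℚ.positive (frac-pos K 1)}}
    (ℚₚ.≤-trans (gap-small K) h)

  within : ∀ K j → dist (leibnizSum (j ℕ.+ K)) (leibnizSum K) ≤ gap K
  within K j = 0≤p≤q⇒∣p∣≤q {A ℚ.- B} {gap K} (0≤diff {B} {A} (lower K j)) (begin
    A ℚ.- B                     ≡⟨ sym (ℚₚ.+-identityʳ (A ℚ.- B)) ⟩
    (A ℚ.- B) ℚ.+ 0ℚ            ≤⟨ ℚₚ.+-monoʳ-≤ (A ℚ.- B) (frac-nonneg 4 (suc (4 ℕ.* (j ℕ.+ K)))) ⟩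
    (A ℚ.- B) ℚ.+ gap (j ℕ.+ K) ≡⟨ solve 3 (λ A B g → (A :- B) :+ g := (A :+ g) :- B) refl A B (gap (j ℕ.+ K)) ⟩
    (A ℚ.+ gap (j ℕ.+ K)) ℚ.- B ≤⟨ ℚₚ.+-monoˡ-≤ (ℚ.- B) (upper K j) ⟩
    (B ℚ.+ gap K) ℚ.- B         ≡⟨ solve 2 (λ B g → (B :+ g) :- B := g) refl B (gap K) ⟩
    gap K                       ∎)
    where
    A = leibnizSum (j ℕ.+ K)
    B = leibnizSum K

  leibniz-cauchy : IsCauchy leibnizSum
  leibniz-cauchy = anchored {leibnizSum} λ ε 0<ε →
    let K , hK = small (ℕ→ℚ 4) 0<ε in
    K , λ k K≤k → subst (λ i → dist (leibnizSum i) (leibnizSum K) ≤ ε) (ℕₚ.m∸n+n≡m K≤k)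
                    (ℚₚ.≤-trans (within K (k ℕ.∸ K)) (gap≤ K hK))

π : ℝ
π = mkℝ leibnizSum Leibniz-Lemmas.leibniz-cauchy

record ℂ : Set where
  constructor _+i_
  field
    re im : ℝ
open ℂ public

infix  4 _≃_ _⟶_
infix  8 -_
infixl 7 _*_ _·_
infixl 6 _+_ _-_

_≃_ : ℂ → ℂ → Set
z ≃ w = re z ≃ᴿ re w × im z ≃ᴿ im w

ℝ→ℂ : ℝ → ℂ
ℝ→ℂ x = x +i 0ᴿ

ℚ→ℂ : ℚ → ℂ
ℚ→ℂ q = ℝ→ℂ (ℚ→ℝ q)

ℕ→ℂ : ℕ → ℂ
ℕ→ℂ n = ℚ→ℂ (ℕ→ℚ n)

_+_ _*_ : ℂ → ℂ → ℂ
z + w = (re z +ᴿ re w) +i (im z +ᴿ im w)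
z * w = (re z *ᴿ re w -ᴿ im z *ᴿ im w) +i (re z *ᴿ im w +ᴿ im z *ᴿ re w)

-_ : ℂ → ℂ
- z = (-ᴿ re z) +i (-ᴿ im z)

_-_ : ℂ → ℂ → ℂ
z - w = z + (- w)

_·_ : ℚ → ℂ → ℂ
q · z = (ℚ→ℝ q *ᴿ re z) +i (ℚ→ℝ q *ᴿ im z)

pow : ℂ → ℕ → ℂ
pow z zero    = ℚ→ℂ 1ℚ
pow z (suc k) = z * pow z k

∣_∣² : ℂ → ℝ
∣ z ∣² = re z *ᴿ re z +ᴿ im z *ᴿ im z

-- z apart from 0, the constructive condition for 1/z to exist.
_#0 : ℂ → Set
z #0 = 0ᴿ <ᴿ ∣ z ∣²

recip : (z : ℂ) → z #0 → ℂ
recip z z#0 = (re z *ᴿ r) +i (-ᴿ (im z *ᴿ r))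
  where r = recipᴿ ∣ z ∣² z#0

_⟶_ : (ℕ → ℂ) → ℂ → Set
f ⟶ z = ((λ k → re (f k)) ⟶ᴿ re z) × ((λ k → im (f k)) ⟶ᴿ im z)

-- The sum of the k terms f a, …, f (a + k − 1).
Σ[_,+_] : ℕ → ℕ → (ℕ → ℂ) → ℂ
Σ[ a ,+ zero  ] f = ℚ→ℂ 0ℚ
Σ[ a ,+ suc k ] f = Σ[ a ,+ k ] f + f (a ℕ.+ k)

-- The series f a + f (a + 1) + … converges to z.
Σ[_,∞]_⇓_ : ℕ → (ℕ → ℂ) → ℂ → Set
Σ[ a ,∞] f ⇓ z = (λ k → Σ[ a ,+ k ] f) ⟶ z

1/_! : ℕ → ℚ
1/ k ! = (+ 1 ℚ./ (k !)) {{k ℕₚ.!≢0}}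

expTerm : ℂ → ℕ → ℂ
expTerm z k = 1/ k ! · pow z k

module Exp-Lemmas where
  open import Data.Rational using (_≤_; _<_)
  open ℚₚ.≤-Reasoning

  2ℚ : ℚ
  2ℚ = 1ℚ ℚ.+ 1ℚ

  qpow : ℚ → ℕ → ℚ
  qpow b zero    = 1ℚ
  qpow b (suc k) = b ℚ.* qpow b k

  qpow-nonneg : ∀ {b} → 0ℚ ≤ b → ∀ k → 0ℚ ≤ qpow b k
  qpow-nonneg 0≤b zero    = ℚₚ.<⇒≤ (ℚₚ.positive⁻¹ 1ℚ)
  qpow-nonneg 0≤b (suc k) = *-nonneg 0≤b (qpow-nonneg 0≤b k)

  module RatioTest (u : ℕ → ℚ) (0≤u : ∀ k → 0ℚ ≤ u k)
                   (K : ℕ) (halves : ∀ k → K ℕ.≤ k → u (suc k) ≤ ½ ℚ.* u k) where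

    decay : ∀ j → u (j ℕ.+ K) ℚ.* ℕ→ℚ (suc j) ≤ u K
    decay zero    = ℚₚ.≤-reflexive (ℚₚ.*-identityʳ (u K))
    decay (suc j) = begin
      u (suc i) ℚ.* ℕ→ℚ (suc (suc j))
        ≤⟨ *-mono-≤ (0≤u (suc i)) (frac-nonneg (2 ℕ.* suc j) 1) (halves i (ℕₚ.m≤n+m K j))
             (frac-≤ (2 ℕ.+ j) 1 (2 ℕ.* suc j) 1 (ℕₚ.*-monoˡ-≤ 1 le)) ⟩
      (½ ℚ.* u i) ℚ.* ℕ→ℚ (2 ℕ.* suc j)
        ≡⟨ cong ((½ ℚ.* u i) ℚ.*_) (sym (frac-* 2 1 (suc j) 1)) ⟩
      (½ ℚ.* u i) ℚ.* (ℕ→ℚ 2 ℚ.* ℕ→ℚ (suc j))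
        ≡⟨ solve 2 (λ a b → (con ½ :* a) :* (con (ℕ→ℚ 2) :* b) := a :* b) refl (u i) (ℕ→ℚ (suc j)) ⟩
      u i ℚ.* ℕ→ℚ (suc j)
        ≤⟨ decay j ⟩
      u K ∎
      where
      i = j ℕ.+ K
      le : 2 ℕ.+ j ℕ.≤ 2 ℕ.* suc j
      le = ℕₚ.≤-trans (ℕₚ.+-monoʳ-≤ 2 (ℕₚ.m≤n*m j 2)) (ℕₚ.≤-reflexive (sym (ℕₚ.*-suc 2 j)))

    tail : ∀ (p : ℕ → ℚ) → (∀ k → dist (p (suc k)) (p k) ≤ u k) → ∀ L → K ℕ.≤ L → ∀ j →
           dist (p (j ℕ.+ L)) (p L) ℚ.+ 2ℚ ℚ.* u (j ℕ.+ L) ≤ 2ℚ ℚ.* u L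
    tail p step L K≤L zero = ℚₚ.≤-reflexive
      (trans (cong (ℚ._+ 2ℚ ℚ.* u L) (dist-self (p L))) (ℚₚ.+-identityˡ (2ℚ ℚ.* u L)))
    tail p step L K≤L (suc j) = begin
      dist (p (suc i)) (p L) ℚ.+ 2ℚ ℚ.* u (suc i)
        ≤⟨ ℚₚ.+-mono-≤
             (ℚₚ.≤-trans (dist-triangle (p (suc i)) (p i) (p L)) (ℚₚ.+-monoˡ-≤ (dist (p i) (p L)) (step i)))
             (ℚₚ.*-monoˡ-≤-nonNeg 2ℚ (halves i (ℕₚ.≤-trans K≤L (ℕₚ.m≤n+m L j)))) ⟩
      (u i ℚ.+ dist (p i) (p L)) ℚ.+ 2ℚ ℚ.* (½ ℚ.* u i)
        ≡⟨ solve 2 (λ u d → (u :+ d) :+ con 2ℚ :* (con ½ :* u) := d :+ con 2ℚ :* u) refl (u i) (dist (p i) (p L)) ⟩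
      dist (p i) (p L) ℚ.+ 2ℚ ℚ.* u i
        ≤⟨ tail p step L K≤L j ⟩
      2ℚ ℚ.* u L ∎
      where i = j ℕ.+ L

    2u≤ : ∀ j {ε} → 2ℚ ℚ.* u K ≤ ε ℚ.* ℕ→ℚ (suc j) → 2ℚ ℚ.* u (j ℕ.+ K) ≤ ε
    2u≤ j {ε} h = ℚₚ.*-cancelʳ-≤-pos (ℕ→ℚ (suc j)) {{ℚ.positive (frac-pos j 1)}} (begin
      (2ℚ ℚ.* u (j ℕ.+ K)) ℚ.* ℕ→ℚ (suc j)  ≡⟨ ℚₚ.*-assoc 2ℚ (u (j ℕ.+ K)) (ℕ→ℚ (suc j)) ⟩
      2ℚ ℚ.* (u (j ℕ.+ K) ℚ.* ℕ→ℚ (suc j))  ≤⟨ ℚₚ.*-monoˡ-≤-nonNeg 2ℚ (decay j) ⟩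
      2ℚ ℚ.* u K                            ≤⟨ h ⟩
      ε ℚ.* ℕ→ℚ (suc j)                     ∎)

    within : ∀ (p : ℕ → ℚ) → (∀ k → dist (p (suc k)) (p k) ≤ u k) → ∀ L → K ℕ.≤ L → ∀ j →
             dist (p (j ℕ.+ L)) (p L) ≤ 2ℚ ℚ.* u L
    within p step L K≤L j = begin
      dist (p (j ℕ.+ L)) (p L)                         ≡⟨ sym (ℚₚ.+-identityʳ _) ⟩
      dist (p (j ℕ.+ L)) (p L) ℚ.+ 0ℚ
        ≤⟨ ℚₚ.+-monoʳ-≤ (dist (p (j ℕ.+ L)) (p L)) (*-nonneg (ℚₚ.<⇒≤ (ℚₚ.positive⁻¹ 2ℚ)) (0≤u (j ℕ.+ L))) ⟩
      dist (p (j ℕ.+ L)) (p L) ℚ.+ 2ℚ ℚ.* u (j ℕ.+ L)  ≤⟨ tail p step L K≤L j ⟩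
      2ℚ ℚ.* u L                                       ∎

    uniform : ∀ ε → 0ℚ < ε → ∃[ L ] ∀ (p : ℕ → ℚ) → (∀ k → dist (p (suc k)) (p k) ≤ u k) →
              ∀ k → L ℕ.≤ k → dist (p k) (p L) ≤ ε
    uniform ε 0<ε =
      let j , hj = small (2ℚ ℚ.* u K) 0<ε
          L      = j ℕ.+ K in
      L , λ p step k L≤k → subst (λ i → dist (p i) (p L) ≤ ε) (ℕₚ.m∸n+n≡m L≤k)
            (ℚₚ.≤-trans (within p step L (ℕₚ.m≤n+m K j) (k ℕ.∸ L)) (2u≤ j hj))

  module _ (z : ℂ) where
    private
      bre = bounded {seq (re z)} (cauchy (re z))
      bim = bounded {seq (im z)} (cauchy (im z))
      B = proj₁ bre ℚ.⊔ proj₁ bim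
      0≤B : 0ℚ ≤ B
      0≤B = ℚₚ.≤-trans (ℚₚ.<⇒≤ (proj₁ (proj₂ bre))) (ℚₚ.p≤p⊔q (proj₁ bre) (proj₁ bim))
      re≤B : ∀ n → ∣ seq (re z) n ∣ ≤ B
      re≤B n = ℚₚ.≤-trans (proj₂ (proj₂ bre) n) (ℚₚ.p≤p⊔q (proj₁ bre) (proj₁ bim))
      im≤B : ∀ n → ∣ seq (im z) n ∣ ≤ B
      im≤B n = ℚₚ.≤-trans (proj₂ (proj₂ bim) n) (ℚₚ.p≤q⊔p (proj₁ bre) (proj₁ bim))
      D = 2ℚ ℚ.* B
      0≤D : 0ℚ ≤ D
      0≤D = *-nonneg (ℚₚ.<⇒≤ (ℚₚ.positive⁻¹ 2ℚ)) 0≤B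

      cross : ∀ {a b c d M} → ∣ a ∣ ≤ B → ∣ b ∣ ≤ B → ∣ c ∣ ≤ M → ∣ d ∣ ≤ M →
              ∣ a ℚ.* c ∣ ℚ.+ ∣ b ℚ.* d ∣ ≤ D ℚ.* M
      cross {a} {b} {c} {d} {M} ha hb hc hd = begin
        ∣ a ℚ.* c ∣ ℚ.+ ∣ b ℚ.* d ∣             ≡⟨ cong₂ ℚ._+_ (ℚₚ.∣p*q∣≡∣p∣*∣q∣ a c) (ℚₚ.∣p*q∣≡∣p∣*∣q∣ b d) ⟩
        ∣ a ∣ ℚ.* ∣ c ∣ ℚ.+ ∣ b ∣ ℚ.* ∣ d ∣
          ≤⟨ ℚₚ.+-mono-≤ (*-mono-≤ (ℚₚ.0≤∣p∣ a) 0≤M ha hc) (*-mono-≤ (ℚₚ.0≤∣p∣ b) 0≤M hb hd) ⟩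
        B ℚ.* M ℚ.+ B ℚ.* M                     ≡⟨ solve 2 (λ B M → B :* M :+ B :* M := (con 2ℚ :* B) :* M) refl B M ⟩
        D ℚ.* M                                 ∎
        where 0≤M = ℚₚ.≤-trans (ℚₚ.0≤∣p∣ c) hc

      pow-bound : ∀ k n → ∣ seq (re (pow z k)) n ∣ ≤ qpow D k × ∣ seq (im (pow z k)) n ∣ ≤ qpow D k
      pow-bound zero    n = ℚₚ.≤-refl , ℚₚ.<⇒≤ (ℚₚ.positive⁻¹ 1ℚ)
      pow-bound (suc k) n with pow-bound k n
      ... | hr , hi =
        ℚₚ.≤-trans (ℚₚ.∣p-q∣≤∣p∣+∣q∣ (x ℚ.* r) (y ℚ.* i)) (cross {x} {y} {r} {i} (re≤B n) (im≤B n) hr hi) ,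
        ℚₚ.≤-trans (ℚₚ.∣p+q∣≤∣p∣+∣q∣ (x ℚ.* i) (y ℚ.* r)) (cross {x} {y} {i} {r} (re≤B n) (im≤B n) hi hr)
        where
        x = seq (re z) n
        y = seq (im z) n
        r = seq (re (pow z k)) n
        i = seq (im (pow z k)) n

      1/!-nonneg : ∀ k → 0ℚ ≤ 1/ k !
      1/!-nonneg k = frac-nonneg 1 (k !) {{k ℕₚ.!≢0}}

      u : ℕ → ℚ
      u k = 1/ k ! ℚ.* qpow D k

      0≤u : ∀ k → 0ℚ ≤ u k
      0≤u k = *-nonneg (1/!-nonneg k) (qpow-nonneg 0≤D k)

      K = proj₁ (archimedean (2ℚ ℚ.* D))

      halves : ∀ k → K ℕ.≤ k → u (suc k) ≤ ½ ℚ.* u k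
      halves k K≤k = begin
        1/ suc k ! ℚ.* (D ℚ.* qpow D k)
          ≡⟨ cong (ℚ._* (D ℚ.* qpow D k))
               (sym (frac-* 1 (suc k) 1 (k !) {{_}} {{k ℕₚ.!≢0}} {{(suc k) ℕₚ.!≢0}})) ⟩
        (1/suc k ℚ.* 1/ k !) ℚ.* (D ℚ.* qpow D k)
          ≡⟨ solve 4 (λ a b d q → (a :* b) :* (d :* q) := (a :* d) :* (b :* q)) refl (1/suc k) (1/ k !) D (qpow D k) ⟩
        (1/suc k ℚ.* D) ℚ.* u k
          ≤⟨ ℚₚ.*-monoʳ-≤-nonNeg (u k) {{ℚ.nonNegative (0≤u k)}} ratio ⟩
        ½ ℚ.* u k ∎
        where
        ratio : 1/suc k ℚ.* D ≤ ½
        ratio = begin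
          1/suc k ℚ.* D
            ≡⟨ solve 2 (λ a d → a :* d := (con ½ :* a) :* (con 2ℚ :* d)) refl (1/suc k) D ⟩
          (½ ℚ.* 1/suc k) ℚ.* (2ℚ ℚ.* D)
            ≤⟨ *-mono-≤ (ℚₚ.<⇒≤ (half-pos (frac-pos 0 (suc k)))) (frac-nonneg (suc k) 1) ℚₚ.≤-refl
                 (ℚₚ.≤-trans (proj₂ (archimedean (2ℚ ℚ.* D)))
                   (frac-≤ K 1 (suc k) 1 (ℕₚ.*-monoˡ-≤ 1 (ℕₚ.m≤n⇒m≤1+n K≤k)))) ⟩
          (½ ℚ.* 1/suc k) ℚ.* ℕ→ℚ (suc k)
            ≡⟨ ℚₚ.*-assoc ½ (1/suc k) (ℕ→ℚ (suc k)) ⟩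
          ½ ℚ.* (1/suc k ℚ.* ℕ→ℚ (suc k))
            ≤⟨ ℚₚ.*-monoˡ-≤-nonNeg ½ (ℚₚ.≤-trans
                 (ℚₚ.≤-reflexive (frac-* 1 (suc k) (suc k) 1))
                 (frac-≤ (1 ℕ.* suc k) (suc k ℕ.* 1) 1 1 (ℕₚ.≤-reflexive (ℕₚ.*-assoc 1 (suc k) 1)))) ⟩
          ½ ℚ.* 1ℚ
            ≡⟨ ℚₚ.*-identityʳ ½ ⟩
          ½ ∎

      open RatioTest u 0≤u K halves

      step : ∀ a b → dist (a ℚ.+ b) a ≡ ∣ b ∣
      step a b = cong ∣_∣ (solve 2 (λ a b → (a :+ b) :- a := b) refl a b)

      term≤ : ∀ k {q} → ∣ q ∣ ≤ qpow D k → ∣ 1/ k ! ℚ.* q ∣ ≤ u k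
      term≤ k {q} h = begin
        ∣ 1/ k ! ℚ.* q ∣      ≡⟨ ℚₚ.∣p*q∣≡∣p∣*∣q∣ (1/ k !) q ⟩
        ∣ 1/ k ! ∣ ℚ.* ∣ q ∣  ≡⟨ cong (ℚ._* ∣ q ∣) (ℚₚ.0≤p⇒∣p∣≡p (1/!-nonneg k)) ⟩
        1/ k ! ℚ.* ∣ q ∣      ≤⟨ ℚₚ.*-monoˡ-≤-nonNeg (1/ k !) {{ℚ.nonNegative (1/!-nonneg k)}} h ⟩
        u k                   ∎

      S : ℕ → ℂ
      S k = Σ[ 0 ,+ k ] (expTerm z)

    re-cauchy : IsCauchy (λ n → seq (re (S n)) n)
    re-cauchy = diagonal-cauchy (λ k → re (S k)) λ ε 0<ε →
      let L , hL = uniform ε 0<ε in L , λ k L≤k n → hL (λ k → seq (re (S k)) n)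
        (λ k → ℚₚ.≤-trans (ℚₚ.≤-reflexive (step (seq (re (S k)) n) (seq (re (expTerm z k)) n)))
                          (term≤ k (proj₁ (pow-bound k n)))) k L≤k

    im-cauchy : IsCauchy (λ n → seq (im (S n)) n)
    im-cauchy = diagonal-cauchy (λ k → im (S k)) λ ε 0<ε →
      let L , hL = uniform ε 0<ε in L , λ k L≤k n → hL (λ k → seq (im (S k)) n)
        (λ k → ℚₚ.≤-trans (ℚₚ.≤-reflexive (step (seq (im (S k)) n) (seq (im (expTerm z k)) n)))
                          (term≤ k (proj₂ (pow-bound k n)))) k L≤k

-- exp z = Σ zᵏ/k!.  The n-th approximation evaluates the n-th partial sum at
-- the n-th approximation of z; the partial sums converge uniformly on the
-- bounded set of approximations of z, so the diagonal has the series' limit.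
exp : ℂ → ℂ
exp z = mkℝ (λ n → seq (re (Σ[ 0 ,+ n ] (expTerm z))) n) (Exp-Lemmas.re-cauchy z)
     +i mkℝ (λ n → seq (im (Σ[ 0 ,+ n ] (expTerm z))) n) (Exp-Lemmas.im-cauchy z)

-- log 0 is left unconstrained; sums over i ≥ 1 never evaluate it.
IsLog : (ℕ → ℝ) → Set
IsLog log = ∀ i → 1 ℕ.≤ i → exp (ℝ→ℂ (log i)) ≃ ℕ→ℂ i

-- 1/iˢ = i⁻ˢ = exp (−s log i), with the real logarithm of i.
1/_^_via_ : ℕ → ℂ → (ℕ → ℝ) → ℂ
1/ i ^ s via log = exp (- (s * ℝ→ℂ (log i)))

-- For general complex w and a, the power wᵃ = exp (a ℓ) is multivalued, with
-- one value for each logarithm ℓ of w.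
IsPower : ℂ → ℂ → ℂ → Set
IsPower w a p = ∃[ ℓ ] exp ℓ ≃ w × exp (a * ℓ) ≃ p

-- The principal power uses the logarithm with −π < Im ℓ ≤ π.  For non-real s
-- the principal value of (m⁻ˢ)^(1/s) is 1/m only if −s log m lies in this strip.
InPrincipalStrip : ℝ → Set
InPrincipalStrip y = (-ᴿ π) <ᴿ y × y ≤ᴿ π

IsPrincipalPower : ℂ → ℂ → ℂ → Set
IsPrincipalPower w a p =
  ∃[ ℓ ] exp ℓ ≃ w × InPrincipalStrip (im ℓ) × exp (a * ℓ) ≃ p

re>1⇒#0 : ∀ s → 1ᴿ <ᴿ re s → s #0
re>1⇒#0 s (δ , 0<δ , N , h) = 1ℚ , ℚₚ.positive⁻¹ 1ℚ , N , bound
  where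
  open ℚₚ.≤-Reasoning
  bound : ∀ n → N ℕ.≤ n → 0ℚ ℚ.+ 1ℚ ℚ.≤ seq ∣ s ∣² n
  bound n N≤n = begin
    1ℚ ℚ.* 1ℚ ℚ.+ 0ℚ     ≤⟨ ℚₚ.+-mono-≤ (*-mono-≤ (ℚₚ.<⇒≤ (ℚₚ.positive⁻¹ 1ℚ)) 0≤x 1≤x 1≤x) sq≥0 ⟩
    x ℚ.* x ℚ.+ y ℚ.* y  ∎
    where
    x = seq (re s) n
    y = seq (im s) n
    1≤x : 1ℚ ℚ.≤ x
    1≤x = ℚₚ.≤-trans (ℚₚ.≤-trans (ℚₚ.≤-reflexive (sym (ℚₚ.+-identityʳ 1ℚ)))
                       (ℚₚ.+-monoʳ-≤ 1ℚ (ℚₚ.<⇒≤ 0<δ))) (h n N≤n)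
    0≤x : 0ℚ ℚ.≤ x
    0≤x = ℚₚ.≤-trans (ℚₚ.<⇒≤ (ℚₚ.positive⁻¹ 1ℚ)) 1≤x
    sq≥0 : 0ℚ ℚ.≤ y ℚ.* y
    sq≥0 with ℚₚ.≤-total 0ℚ y
    ... | inj₁ 0≤y = *-nonneg 0≤y 0≤y
    ... | inj₂ y≤0 = subst (0ℚ ℚ.≤_) (solve 1 (λ y → (:- y) :* (:- y) := y :* y) refl y)
                       (*-nonneg (ℚₚ.neg-antimono-≤ y≤0) (ℚₚ.neg-antimono-≤ y≤0))

centralBinomial : ℕ → ℚ
centralBinomial n = ℕ→ℚ ((2 ℕ.* n) C n)

catalan : ℕ → ℚ
catalan n = 1/suc n ℚ.* centralBinomial n

{-# OPTIONS --safe #-}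
-- The bracket telescopes to the single term (n + 1)⁻ˢ = exp ℓ with
-- ℓ = −s log (n + 1), so its power 1/s is exp (ℓ/s) = exp (−log (n + 1)) = 1/(n + 1).
-- The last two equalities need that exp respects ≃ (its partial sums are Lipschitz
-- in the argument, uniformly on bounded sets) and that exp (−x) inverts exp x for
-- real x: by the Cauchy product, the n-th partial sums at x and −x multiply to 1 up
-- to E₂ₙ(2B) − Eₙ(2B), where Eₙ is the n-th partial sum and |x| ≤ B.
module Submission where

open import Defs
open import Data.Nat using (ℕ; suc) renaming (_+_ to _+ℕ_; _≤_ to _≤ℕ_)
open import Data.Product using (_×_; ∃-syntax; _,_; proj₁; proj₂)
open import Data.Nat as ℕ using (zero)
import Data.Nat.Properties as ℕₚ
open import Data.Integer as ℤ using (+_)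
import Data.Integer.Properties as ℤₚ
open import Data.Sum using (inj₁; inj₂)
open import Data.Rational as ℚ using (ℚ; 0ℚ; 1ℚ; ½; ∣_∣; _≤_; _<_)
import Data.Rational.Properties as ℚₚ
import Data.Rational.Unnormalised as ℚᵘ
import Data.Rational.Unnormalised.Properties as ℚᵘₚ
open import Data.Rational.Solver using (module +-*-Solver)
open import Relation.Binary.PropositionalEquality
  using (_≡_; refl; sym; trans; cong; cong₂; subst; subst₂; module ≡-Reasoning)

open +-*-Solver
open ℚ-Lemmas
open Cauchy-Lemmas using (bounded)
open Exp-Lemmas using (qpow; qpow-nonneg)

-- Null sequences and equality of reals

p≤∣p∣ : ∀ p → p ≤ ∣ p ∣
p≤∣p∣ p with ℚₚ.≤-total 0ℚ p
... | inj₁ 0≤p = ℚₚ.≤-reflexive (sym (ℚₚ.0≤p⇒∣p∣≡p 0≤p))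
... | inj₂ p≤0 = ℚₚ.≤-trans p≤0 (ℚₚ.0≤∣p∣ p)

-- `x ≃ᴿ y` unfolds to `Null` of the difference of the two sequences, so the closure properties of
-- null sequences apply directly to equality of reals.
Null : (ℕ → ℚ) → Set
Null e = ∀ ε → 0ℚ < ε → ∃[ N ] ∀ n → N ≤ℕ n → ∣ e n ∣ ≤ ε

module _ where
  open ℚₚ.≤-Reasoning

  null-≤ : ∀ {e f} N → (∀ n → N ≤ℕ n → ∣ e n ∣ ≤ ∣ f n ∣) → Null f → Null e
  null-≤ N h nf ε 0<ε with nf ε 0<ε
  ... | M , hM = N ℕ.⊔ M , λ n p → ℚₚ.≤-trans
    (h n (ℕₚ.m⊔n≤o⇒m≤o N M p)) (hM n (ℕₚ.m⊔n≤o⇒n≤o N M p))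

  null-≗ : ∀ {e f} → (∀ n → e n ≡ f n) → Null f → Null e
  null-≗ h = null-≤ 0 λ n _ → ℚₚ.≤-reflexive (cong ∣_∣ (h n))

  null-0 : ∀ {e} N → (∀ n → N ≤ℕ n → e n ≡ 0ℚ) → Null e
  null-0 N h ε 0<ε = N , λ n p → ℚₚ.≤-trans (ℚₚ.≤-reflexive (cong ∣_∣ (h n p))) (ℚₚ.<⇒≤ 0<ε)

  null-+ : ∀ {e f} → Null e → Null f → Null (λ n → e n ℚ.+ f n)
  null-+ {e} {f} ne nf ε 0<ε with ne (½ ℚ.* ε) (half-pos 0<ε) | nf (½ ℚ.* ε) (half-pos 0<ε)
  ... | N , hN | M , hM = N ℕ.⊔ M , λ n p → begin
    ∣ e n ℚ.+ f n ∣           ≤⟨ ℚₚ.∣p+q∣≤∣p∣+∣q∣ (e n) (f n) ⟩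
    ∣ e n ∣ ℚ.+ ∣ f n ∣       ≤⟨ ℚₚ.+-mono-≤ (hN n (ℕₚ.m⊔n≤o⇒m≤o N M p)) (hM n (ℕₚ.m⊔n≤o⇒n≤o N M p)) ⟩
    ½ ℚ.* ε ℚ.+ ½ ℚ.* ε       ≡⟨ half+half ε ⟩
    ε                         ∎

  null-∣∣ : ∀ {e} → Null e → Null (λ n → ∣ e n ∣)
  null-∣∣ {e} = null-≤ 0 λ n _ → ℚₚ.≤-reflexive (ℚₚ.∣∣p∣∣≡∣p∣ (e n))

  null-* : ∀ (c : ℕ → ℚ) {e} C → 0ℚ < C → (∀ n → ∣ c n ∣ ≤ C) → Null e → Null (λ n → c n ℚ.* e n)
  null-* c {e} C 0<C hC ne ε 0<ε with ne (ε ℚ.* C⁻¹) (*-pos 0<ε 0<C⁻¹)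
    where
    C⁻¹ = (ℚ.1/ C) {{ℚ.>-nonZero 0<C}}
    0<C⁻¹ : 0ℚ < C⁻¹
    0<C⁻¹ = ℚₚ.positive⁻¹ _ {{ℚₚ.1/pos⇒pos C {{ℚ.positive 0<C}}}}
  ... | N , hN = N , λ n p → begin
    ∣ c n ℚ.* e n ∣           ≡⟨ ℚₚ.∣p*q∣≡∣p∣*∣q∣ (c n) (e n) ⟩
    ∣ c n ∣ ℚ.* ∣ e n ∣       ≤⟨ *-mono-≤ (ℚₚ.0≤∣p∣ (c n)) (ℚₚ.≤-trans (ℚₚ.0≤∣p∣ (e n)) (hN n p)) (hC n) (hN n p) ⟩
    C ℚ.* (ε ℚ.* _)           ≡⟨ solve 3 (λ C ε D → C :* (ε :* D) := ε :* (C :* D)) refl C ε _ ⟩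
    ε ℚ.* (C ℚ.* _)           ≡⟨ cong (ε ℚ.*_) (ℚₚ.*-inverseʳ C {{ℚ.>-nonZero 0<C}}) ⟩
    ε ℚ.* 1ℚ                  ≡⟨ ℚₚ.*-identityʳ ε ⟩
    ε                         ∎

≃ᴿ-eventually : ∀ {x y} N → (∀ n → N ≤ℕ n → seq x n ≡ seq y n) → x ≃ᴿ y
≃ᴿ-eventually {x} {y} N h = null-0 N λ n p →
  trans (cong (ℚ._- seq y n) (h n p)) (ℚₚ.+-inverseʳ (seq y n))

≃ᴿ-pointwise : ∀ {x y} → (∀ n → seq x n ≡ seq y n) → x ≃ᴿ y
≃ᴿ-pointwise {x} {y} h = ≃ᴿ-eventually {x} {y} 0 (λ n _ → h n)

≃ᴿ-sym : ∀ {x y} → x ≃ᴿ y → y ≃ᴿ x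
≃ᴿ-sym {x} {y} = null-≤ 0 λ n _ → ℚₚ.≤-reflexive (dist-sym (seq y n) (seq x n))

≃ᴿ-trans : ∀ {x y z} → x ≃ᴿ y → y ≃ᴿ z → x ≃ᴿ z
≃ᴿ-trans {x} {y} {z} p q = null-≤ 0 (λ n _ → ℚₚ.≤-reflexive (cong ∣_∣
  (solve 3 (λ x y z → x :- z := (x :- y) :+ (y :- z)) refl (seq x n) (seq y n) (seq z n))))
  (null-+ p q)

-- A Cauchy sequence is bounded, and a bounded factor keeps a null difference null.
*ᴿ-congˡ : ∀ {x y z} → y ≃ᴿ z → (x *ᴿ y) ≃ᴿ (x *ᴿ z)
*ᴿ-congˡ {x} {y} {z} p with bounded {seq x} (cauchy x)
... | C , 0<C , hC = null-≤ 0 (λ n _ → ℚₚ.≤-reflexive (cong ∣_∣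
  (solve 3 (λ x y z → x :* y :- x :* z := x :* (y :- z)) refl (seq x n) (seq y n) (seq z n))))
  (null-* (seq x) {λ n → seq y n ℚ.- seq z n} C 0<C hC p)

≃-refl : ∀ {z} → z ≃ z
≃-refl {z} = ≃ᴿ-pointwise {re z} {re z} (λ _ → refl) , ≃ᴿ-pointwise {im z} {im z} (λ _ → refl)

≃-sym : ∀ {z w} → z ≃ w → w ≃ z
≃-sym {z} {w} (p , q) = ≃ᴿ-sym {re z} {re w} p , ≃ᴿ-sym {im z} {im w} q

≃-trans : ∀ {u v w} → u ≃ v → v ≃ w → u ≃ w
≃-trans {u} {v} {w} (p , q) (p′ , q′) =
  ≃ᴿ-trans {re u} {re v} {re w} p p′ , ≃ᴿ-trans {im u} {im v} {im w} q q′

-- Naturals and inverse factorials as rationals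

frac-≡ : ∀ a b c d .{{_ : ℕ.NonZero b}} .{{_ : ℕ.NonZero d}} →
         a ℕ.* d ≡ c ℕ.* b → (+ a ℚ./ b) ≡ (+ c ℚ./ d)
frac-≡ a b c d h = ℚₚ.≤-antisym
  (frac-≤ a b c d (ℕₚ.≤-reflexive h)) (frac-≤ c d a b (ℕₚ.≤-reflexive (sym h)))

-- `ℕ→ℚ` normalises its fraction and does not compute on a variable, so the equation is checked on
-- unnormalised fractions.
ℕ→ℚ-suc : ∀ k → ℕ→ℚ (suc k) ≡ 1ℚ ℚ.+ ℕ→ℚ k
ℕ→ℚ-suc k = ℚₚ.toℚᵘ-injective
  (ℚᵘₚ.≃-trans (ℚₚ.toℚᵘ-fromℚᵘ (+ suc k ℚᵘ./ 1))
  (ℚᵘₚ.≃-trans (ℚᵘ.*≡* (cong (λ i → (+ 1 ℤ.+ i) ℤ.* + 1) (sym (ℤₚ.*-identityʳ (+ k)))))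
  (ℚᵘₚ.≃-trans (ℚᵘₚ.+-congʳ (ℚ.toℚᵘ 1ℚ) (ℚᵘₚ.≃-sym (ℚₚ.toℚᵘ-fromℚᵘ (+ k ℚᵘ./ 1))))
    (ℚᵘₚ.≃-sym (ℚₚ.toℚᵘ-homo-+ 1ℚ (ℕ→ℚ k))))))

-- Strips the factor `k + 1` that a formal derivative puts on the next coefficient.
ℕ→ℚ-suc-cancel : ∀ k {p q} → ℕ→ℚ (suc k) ℚ.* p ≡ ℕ→ℚ (suc k) ℚ.* q → p ≡ q
ℕ→ℚ-suc-cancel k h = ℚₚ.≤-antisym
  (ℚₚ.*-cancelˡ-≤-pos (ℕ→ℚ (suc k)) {{ℚ.positive (frac-pos k 1)}} (ℚₚ.≤-reflexive h))
  (ℚₚ.*-cancelˡ-≤-pos (ℕ→ℚ (suc k)) {{ℚ.positive (frac-pos k 1)}} (ℚₚ.≤-reflexive (sym h)))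

1/suc-inverse : ∀ k → 1/suc k ℚ.* ℕ→ℚ (suc k) ≡ 1ℚ
1/suc-inverse k = trans (frac-* 1 (suc k) (suc k) 1)
  (frac-≡ (1 ℕ.* suc k) (suc k ℕ.* 1) 1 1 (ℕₚ.*-assoc 1 (suc k) 1))

1/!-suc : ∀ k → ℕ→ℚ (suc k) ℚ.* 1/ suc k ! ≡ 1/ k !
1/!-suc k = begin
  ℕ→ℚ (suc k) ℚ.* 1/ suc k !
    ≡⟨ cong (ℕ→ℚ (suc k) ℚ.*_) (sym (frac-* 1 (suc k) 1 (k ℕ.!) {{_}} {{k ℕₚ.!≢0}} {{(suc k) ℕₚ.!≢0}})) ⟩
  ℕ→ℚ (suc k) ℚ.* (1/suc k ℚ.* 1/ k !)
    ≡⟨ solve 3 (λ a b c → a :* (b :* c) := (b :* a) :* c) refl (ℕ→ℚ (suc k)) (1/suc k) (1/ k !) ⟩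
  (1/suc k ℚ.* ℕ→ℚ (suc k)) ℚ.* 1/ k !
    ≡⟨ cong (ℚ._* 1/ k !) (1/suc-inverse k) ⟩
  1ℚ ℚ.* 1/ k !
    ≡⟨ ℚₚ.*-identityˡ (1/ k !) ⟩
  1/ k ! ∎
  where open ≡-Reasoning

1/!-nonneg : ∀ k → 0ℚ ≤ 1/ k !
1/!-nonneg k = frac-nonneg 1 (k ℕ.!) {{k ℕₚ.!≢0}}

-- Partial sums and the Cauchy product

psum : (ℕ → ℚ) → ℕ → ℚ
psum u zero    = 0ℚ
psum u (suc k) = psum u k ℚ.+ u k

shift : (ℕ → ℚ) → ℕ → ℚ
shift u k = u (suc k)

-- The Cauchy product, the sum of `t j * u k` over `j + k = n`. Peeling off `t 0` and shifting `t`
-- avoids subtraction of indices.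
conv : (t u : ℕ → ℚ) → ℕ → ℚ
conv t u zero    = t 0 ℚ.* u 0
conv t u (suc n) = t 0 ℚ.* u (suc n) ℚ.+ conv (shift t) u n

module _ where
  open ≡-Reasoning

  psum-cong : ∀ {t u} → (∀ k → t k ≡ u k) → ∀ n → psum t n ≡ psum u n
  psum-cong h zero    = refl
  psum-cong h (suc n) = cong₂ ℚ._+_ (psum-cong h n) (h n)

  psum-0 : ∀ n → psum (λ _ → 0ℚ) n ≡ 0ℚ
  psum-0 zero    = refl
  psum-0 (suc n) = cong (ℚ._+ 0ℚ) (psum-0 n)

  psum-split : ∀ u n k → psum u (k +ℕ n) ≡ psum u n ℚ.+ psum (λ j → u (n +ℕ j)) k
  psum-split u n zero    = sym (ℚₚ.+-identityʳ (psum u n))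
  psum-split u n (suc k) = trans
    (cong₂ ℚ._+_ (psum-split u n k) (cong u (ℕₚ.+-comm k n)))
    (ℚₚ.+-assoc (psum u n) (psum (λ j → u (n +ℕ j)) k) (u (n +ℕ k)))

  psum-shift : ∀ u k → psum u (suc k) ≡ u 0 ℚ.+ psum (shift u) k
  psum-shift u zero    = solve 1 (λ a → con 0ℚ :+ a := a :+ con 0ℚ) refl (u 0)
  psum-shift u (suc k) = trans (cong (ℚ._+ u (suc k)) (psum-shift u k))
    (ℚₚ.+-assoc (u 0) (psum (shift u) k) (u (suc k)))

  -- Cuts the triangle of index pairs `j + k ≤ n` into its row `j = 0` and the smaller triangle
  -- belonging to `shift t`; the estimates on products of partial sums recurse along this cut.
  psum-conv-shift : ∀ t u n →
    psum (conv t u) (suc n) ≡ t 0 ℚ.* psum u (suc n) ℚ.+ psum (conv (shift t) u) n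
  psum-conv-shift t u zero    = solve 2
    (λ a b → con 0ℚ :+ a :* b := a :* (con 0ℚ :+ b) :+ con 0ℚ) refl (t 0) (u 0)
  psum-conv-shift t u (suc n) = trans
    (cong (ℚ._+ conv t u (suc n)) (psum-conv-shift t u n))
    (solve 5 (λ a s b c d → (a :* s :+ c) :+ (a :* b :+ d) := a :* (s :+ b) :+ (c :+ d)) refl
      (t 0) (psum u (suc n)) (u (suc n)) (psum (conv (shift t) u) n) (conv (shift t) u n))

  conv-congˡ : ∀ {t t′} u → (∀ k → t k ≡ t′ k) → ∀ n → conv t u n ≡ conv t′ u n
  conv-congˡ u h zero    = cong (ℚ._* u 0) (h 0)
  conv-congˡ u h (suc n) = cong₂ ℚ._+_ (cong (ℚ._* u (suc n)) (h 0)) (conv-congˡ u (λ k → h (suc k)) n)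

  conv-congʳ : ∀ t {u u′} → (∀ k → u k ≡ u′ k) → ∀ n → conv t u n ≡ conv t u′ n
  conv-congʳ t h zero    = cong (t 0 ℚ.*_) (h 0)
  conv-congʳ t h (suc n) = cong₂ ℚ._+_ (cong (t 0 ℚ.*_) (h (suc n))) (conv-congʳ (shift t) h n)

  conv-+ˡ : ∀ t t′ u n → conv (λ k → t k ℚ.+ t′ k) u n ≡ conv t u n ℚ.+ conv t′ u n
  conv-+ˡ t t′ u zero    = ℚₚ.*-distribʳ-+ (u 0) (t 0) (t′ 0)
  conv-+ˡ t t′ u (suc n) = trans
    (cong ((t 0 ℚ.+ t′ 0) ℚ.* u (suc n) ℚ.+_) (conv-+ˡ (shift t) (shift t′) u n))
    (solve 5 (λ a b c d e → (a :+ b) :* c :+ (d :+ e) := (a :* c :+ d) :+ (b :* c :+ e)) refl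
      (t 0) (t′ 0) (u (suc n)) (conv (shift t) u n) (conv (shift t′) u n))

  conv-*ˡ : ∀ a t u n → conv (λ k → a ℚ.* t k) u n ≡ a ℚ.* conv t u n
  conv-*ˡ a t u zero    = ℚₚ.*-assoc a (t 0) (u 0)
  conv-*ˡ a t u (suc n) = trans
    (cong ((a ℚ.* t 0) ℚ.* u (suc n) ℚ.+_) (conv-*ˡ a (shift t) u n))
    (solve 4 (λ a b c d → (a :* b) :* c :+ a :* d := a :* (b :* c :+ d)) refl
      a (t 0) (u (suc n)) (conv (shift t) u n))

  conv-*ʳ : ∀ a t u n → conv t (λ k → a ℚ.* u k) n ≡ a ℚ.* conv t u n
  conv-*ʳ a t u zero    = solve 3 (λ a b c → b :* (a :* c) := a :* (b :* c)) refl a (t 0) (u 0)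
  conv-*ʳ a t u (suc n) = trans
    (cong (t 0 ℚ.* (a ℚ.* u (suc n)) ℚ.+_) (conv-*ʳ a (shift t) u n))
    (solve 4 (λ a b c d → b :* (a :* c) :+ a :* d := a :* (b :* c :+ d)) refl
      a (t 0) (u (suc n)) (conv (shift t) u n))

  -- Coefficients of the formal derivative of the power series with coefficients `t`.
  deriv : (ℕ → ℚ) → ℕ → ℚ
  deriv t k = ℕ→ℚ (suc k) ℚ.* t (suc k)

  -- With `S` for `shift t`, this is the positive-degree part of (t 0 + X S)′ = S + X S′.
  shift-deriv : ∀ t k → shift (deriv t) k ≡ shift (shift t) k ℚ.+ deriv (shift t) k
  shift-deriv t k = trans (cong (ℚ._* t (2 +ℕ k)) (ℕ→ℚ-suc (suc k)))
    (solve 2 (λ a b → (con 1ℚ :+ a) :* b := b :+ a :* b) refl (ℕ→ℚ (suc k)) (t (2 +ℕ k)))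

  -- The Leibniz rule for formal power series, by induction on `n` for all `t` at once.
  conv-deriv : ∀ t u n → deriv (conv t u) n ≡ conv (deriv t) u n ℚ.+ conv t (deriv u) n
  conv-deriv t u zero    = solve 4
    (λ a b c d → con 1ℚ :* (a :* b :+ c :* d) := (con 1ℚ :* c) :* d :+ a :* (con 1ℚ :* b)) refl
    (t 0) (u 1) (t 1) (u 0)
  conv-deriv t u (suc n) = begin
    k ℚ.* (a ℚ.* b ℚ.+ conv St u (suc n))
      ≡⟨ cong (λ x → x ℚ.* (a ℚ.* b ℚ.+ conv St u (suc n))) (ℕ→ℚ-suc (suc n)) ⟩
    -- In the weight `n + 2 = 1 + l` on `conv St u (suc n)`, the part `l` calls the induction
    -- hypothesis. The remaining single copy unfolds and supplies the extra summand of
    -- `shift-deriv`.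
    (1ℚ ℚ.+ l) ℚ.* (a ℚ.* b ℚ.+ conv St u (suc n))
      ≡⟨ solve 4 (λ l a b c → (con 1ℚ :+ l) :* (a :* b :+ c)
                   := (a :* ((con 1ℚ :+ l) :* b) :+ c) :+ l :* c) refl l a b (conv St u (suc n)) ⟩
    (a ℚ.* ((1ℚ ℚ.+ l) ℚ.* b) ℚ.+ conv St u (suc n)) ℚ.+ l ℚ.* conv St u (suc n)
      ≡⟨ cong₂ (λ x y → (a ℚ.* (x ℚ.* b) ℚ.+ conv St u (suc n)) ℚ.+ y)
           (sym (ℕ→ℚ-suc (suc n))) (conv-deriv St u n) ⟩
    (a ℚ.* (k ℚ.* b) ℚ.+ (t 1 ℚ.* u (suc n) ℚ.+ conv (shift St) u n))
      ℚ.+ (conv (deriv St) u n ℚ.+ conv St (deriv u) n)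
      ≡⟨ solve 6 (λ p x y v w q → (p :+ (x :* y :+ v)) :+ (w :+ q)
                   := ((con 1ℚ :* x) :* y :+ (v :+ w)) :+ (p :+ q)) refl
           (a ℚ.* (k ℚ.* b)) (t 1) (u (suc n)) (conv (shift St) u n) (conv (deriv St) u n) (conv St (deriv u) n) ⟩
    ((1ℚ ℚ.* t 1) ℚ.* u (suc n) ℚ.+ (conv (shift St) u n ℚ.+ conv (deriv St) u n))
      ℚ.+ (a ℚ.* (k ℚ.* b) ℚ.+ conv St (deriv u) n)
      ≡⟨ cong (λ x → ((1ℚ ℚ.* t 1) ℚ.* u (suc n) ℚ.+ x) ℚ.+ (a ℚ.* (k ℚ.* b) ℚ.+ conv St (deriv u) n))
           (sym (trans (conv-congˡ u (shift-deriv t) n) (conv-+ˡ (shift St) (deriv St) u n))) ⟩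
    conv (deriv t) u (suc n) ℚ.+ conv t (deriv u) (suc n) ∎
    where
    St = shift t
    k = ℕ→ℚ (2 +ℕ n)
    l = ℕ→ℚ (suc n)
    a = t 0
    b = u (2 +ℕ n)

-- Majorants for partial sums and products

module _ where
  open ℚₚ.≤-Reasoning

  psum-nonneg : ∀ {u} → (∀ k → 0ℚ ≤ u k) → ∀ n → 0ℚ ≤ psum u n
  psum-nonneg h zero    = ℚₚ.≤-refl
  psum-nonneg h (suc n) = ℚₚ.+-mono-≤ (psum-nonneg h n) (h n)

  conv-nonneg : ∀ {t u} → (∀ k → 0ℚ ≤ t k) → (∀ k → 0ℚ ≤ u k) → ∀ n → 0ℚ ≤ conv t u n
  conv-nonneg ht hu zero    = *-nonneg (ht 0) (hu 0)
  conv-nonneg ht hu (suc n) = ℚₚ.+-mono-≤ (*-nonneg (ht 0) (hu (suc n))) (conv-nonneg (λ k → ht (suc k)) hu n)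

  dist-psum : ∀ {u v} → (∀ k → ∣ u k ∣ ≤ v k) → ∀ j q →
              ∣ psum u (j +ℕ q) ℚ.- psum u q ∣ ≤ psum v (j +ℕ q) ℚ.- psum v q
  dist-psum {u} {v} h zero q = ℚₚ.≤-reflexive (trans (dist-self (psum u q)) (sym (ℚₚ.+-inverseʳ (psum v q))))
  dist-psum {u} {v} h (suc j) q = begin
    ∣ (psum u i ℚ.+ u i) ℚ.- psum u q ∣
      ≡⟨ cong ∣_∣ (solve 3 (λ a b c → (a :+ b) :- c := (a :- c) :+ b) refl (psum u i) (u i) (psum u q)) ⟩
    ∣ (psum u i ℚ.- psum u q) ℚ.+ u i ∣
      ≤⟨ ℚₚ.∣p+q∣≤∣p∣+∣q∣ (psum u i ℚ.- psum u q) (u i) ⟩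
    ∣ psum u i ℚ.- psum u q ∣ ℚ.+ ∣ u i ∣
      ≤⟨ ℚₚ.+-mono-≤ (dist-psum h j q) (h i) ⟩
    (psum v i ℚ.- psum v q) ℚ.+ v i
      ≡⟨ solve 3 (λ a b c → (a :- c) :+ b := (a :+ b) :- c) refl (psum v i) (v i) (psum v q) ⟩
    psum v (suc i) ℚ.- psum v q ∎
    where i = j +ℕ q

  ∣psum∣≤ : ∀ {u v} → (∀ k → ∣ u k ∣ ≤ v k) → ∀ n → ∣ psum u n ∣ ≤ psum v n
  ∣psum∣≤ h zero = ℚₚ.≤-refl
  ∣psum∣≤ {u} {v} h (suc n) = ℚₚ.≤-trans (ℚₚ.∣p+q∣≤∣p∣+∣q∣ (psum u n) (u n)) (ℚₚ.+-mono-≤ (∣psum∣≤ h n) (h n))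

  psum-mono : ∀ {u} → (∀ k → 0ℚ ≤ u k) → ∀ j q → psum u q ≤ psum u (j +ℕ q)
  psum-mono h zero    q = ℚₚ.≤-refl
  psum-mono {u} h (suc j) q = begin
    psum u q                   ≤⟨ psum-mono h j q ⟩
    psum u (j +ℕ q)            ≡⟨ sym (ℚₚ.+-identityʳ _) ⟩
    psum u (j +ℕ q) ℚ.+ 0ℚ     ≤⟨ ℚₚ.+-monoʳ-≤ (psum u (j +ℕ q)) (h (j +ℕ q)) ⟩
    psum u (suc j +ℕ q)        ∎

  ∣p*q∣≤ : ∀ {p q a b} → ∣ p ∣ ≤ a → ∣ q ∣ ≤ b → ∣ p ℚ.* q ∣ ≤ a ℚ.* b
  ∣p*q∣≤ {p} {q} hp hq = ℚₚ.≤-trans (ℚₚ.≤-reflexive (ℚₚ.∣p*q∣≡∣p∣*∣q∣ p q))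
    (*-mono-≤ (ℚₚ.0≤∣p∣ p) (ℚₚ.≤-trans (ℚₚ.0≤∣p∣ q) hq) hp hq)

  -- The rectangle minus the triangle is a sum of products t j * u k, so it is
  -- dominated by the same sum for the majorants.
  product-conv-dist : ∀ {t u t′ u′} → (∀ k → ∣ t k ∣ ≤ t′ k) → (∀ k → ∣ u k ∣ ≤ u′ k) → ∀ n i j →
    ∣ psum t (n +ℕ i) ℚ.* psum u (j +ℕ n) ℚ.- psum (conv t u) n ∣
      ≤ psum t′ (n +ℕ i) ℚ.* psum u′ (j +ℕ n) ℚ.- psum (conv t′ u′) n
  product-conv-dist {t} {u} {t′} {u′} ht hu zero i j = begin
    ∣ psum t i ℚ.* psum u (j +ℕ 0) ℚ.- 0ℚ ∣   ≡⟨ cong ∣_∣ (ℚₚ.+-identityʳ _) ⟩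
    ∣ psum t i ℚ.* psum u (j +ℕ 0) ∣          ≤⟨ ∣p*q∣≤ (∣psum∣≤ ht i) (∣psum∣≤ hu (j +ℕ 0)) ⟩
    psum t′ i ℚ.* psum u′ (j +ℕ 0)            ≡⟨ sym (ℚₚ.+-identityʳ _) ⟩
    psum t′ i ℚ.* psum u′ (j +ℕ 0) ℚ.- 0ℚ     ∎
  product-conv-dist {t} {u} {t′} {u′} ht hu (suc n) i j = begin
    ∣ psum t (suc n +ℕ i) ℚ.* U ℚ.- psum (conv t u) (suc n) ∣
      ≡⟨ cong ∣_∣ (regroup t u) ⟩
    ∣ t 0 ℚ.* (U ℚ.- psum u (suc n)) ℚ.+ (psum (shift t) (n +ℕ i) ℚ.* U ℚ.- psum (conv (shift t) u) n) ∣
      ≤⟨ ℚₚ.∣p+q∣≤∣p∣+∣q∣ (t 0 ℚ.* (U ℚ.- psum u (suc n))) _ ⟩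
    ∣ t 0 ℚ.* (U ℚ.- psum u (suc n)) ∣ ℚ.+ ∣ psum (shift t) (n +ℕ i) ℚ.* U ℚ.- psum (conv (shift t) u) n ∣
      ≤⟨ ℚₚ.+-mono-≤ (∣p*q∣≤ (ht 0) (dist-psum hu j (suc n)))
           -- The right factor keeps its length `j + suc n` while the triangle shrinks to size `n`,
           -- so the offset grows to `suc j`.
           (subst (λ k → ∣ psum (shift t) (n +ℕ i) ℚ.* psum u k ℚ.- psum (conv (shift t) u) n ∣
                       ≤ psum (shift t′) (n +ℕ i) ℚ.* psum u′ k ℚ.- psum (conv (shift t′) u′) n)
             (sym (ℕₚ.+-suc j n))
             (product-conv-dist (λ k → ht (suc k)) hu n i (suc j))) ⟩
    t′ 0 ℚ.* (U′ ℚ.- psum u′ (suc n)) ℚ.+ (psum (shift t′) (n +ℕ i) ℚ.* U′ ℚ.- psum (conv (shift t′) u′) n)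
      ≡⟨ sym (regroup t′ u′) ⟩
    psum t′ (suc n +ℕ i) ℚ.* U′ ℚ.- psum (conv t′ u′) (suc n) ∎
    where
    U = psum u (j +ℕ suc n)
    U′ = psum u′ (j +ℕ suc n)
    regroup : ∀ t u → let U = psum u (j +ℕ suc n) in
      psum t (suc n +ℕ i) ℚ.* U ℚ.- psum (conv t u) (suc n)
        ≡ t 0 ℚ.* (U ℚ.- psum u (suc n)) ℚ.+ (psum (shift t) (n +ℕ i) ℚ.* U ℚ.- psum (conv (shift t) u) n)
    regroup t u = trans
      (cong₂ (λ a b → a ℚ.* psum u (j +ℕ suc n) ℚ.- b) (psum-shift t (n +ℕ i)) (psum-conv-shift t u n))
      (solve 5 (λ a s U v c → (a :+ s) :* U :- (a :* v :+ c) := a :* (U :- v) :+ (s :* U :- c)) refl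
        (t 0) (psum (shift t) (n +ℕ i)) (psum u (j +ℕ suc n)) (psum u (suc n)) (psum (conv (shift t) u) n))

  -- The `p` by `q` rectangle of index pairs lies inside the triangle `j + k < p + q`, and all terms
  -- are nonnegative.
  product≤conv : ∀ {t u} → (∀ k → 0ℚ ≤ t k) → (∀ k → 0ℚ ≤ u k) → ∀ p q →
    psum t p ℚ.* psum u q ≤ psum (conv t u) (p +ℕ q)
  product≤conv {t} {u} ht hu zero q = ℚₚ.≤-trans
    (ℚₚ.≤-reflexive (ℚₚ.*-zeroˡ (psum u q))) (psum-nonneg (conv-nonneg ht hu) q)
  product≤conv {t} {u} ht hu (suc p) q = begin
    psum t (suc p) ℚ.* psum u q
      ≡⟨ trans (cong (ℚ._* psum u q) (psum-shift t p)) (ℚₚ.*-distribʳ-+ (psum u q) (t 0) (psum (shift t) p)) ⟩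
    t 0 ℚ.* psum u q ℚ.+ psum (shift t) p ℚ.* psum u q
      ≤⟨ ℚₚ.+-mono-≤ (ℚₚ.*-monoˡ-≤-nonNeg (t 0) {{ℚ.nonNegative (ht 0)}} (psum-mono hu (suc p) q))
           (product≤conv (λ k → ht (suc k)) hu p q) ⟩
    t 0 ℚ.* psum u (suc p +ℕ q) ℚ.+ psum (conv (shift t) u) (p +ℕ q)
      ≡⟨ sym (psum-conv-shift t u (p +ℕ q)) ⟩
    psum (conv t u) (suc p +ℕ q) ∎

-- The exponential series over ℚ

expCoeff : ℚ → ℕ → ℚ
expCoeff q k = 1/ k ! ℚ.* qpow q k

expSum : ℚ → ℕ → ℚ
expSum q = psum (expCoeff q)

module _ where
  open ≡-Reasoning

  -- The differential equation h′ = q h of the exponential series, read on coefficients.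
  deriv-expCoeff : ∀ q k → deriv (expCoeff q) k ≡ q ℚ.* expCoeff q k
  deriv-expCoeff q k = begin
    ℕ→ℚ (suc k) ℚ.* (1/ suc k ! ℚ.* (q ℚ.* qpow q k))
      ≡⟨ solve 4 (λ a b c d → a :* (b :* (c :* d)) := c :* ((a :* b) :* d)) refl
           (ℕ→ℚ (suc k)) (1/ suc k !) q (qpow q k) ⟩
    q ℚ.* ((ℕ→ℚ (suc k) ℚ.* 1/ suc k !) ℚ.* qpow q k)
      ≡⟨ cong (λ x → q ℚ.* (x ℚ.* qpow q k)) (1/!-suc k) ⟩
    q ℚ.* expCoeff q k ∎

  -- Both sides satisfy h′ = (a + b) h.
  conv-expCoeff : ∀ a b n → conv (expCoeff a) (expCoeff b) n ≡ expCoeff (a ℚ.+ b) n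
  conv-expCoeff a b zero    = refl
  conv-expCoeff a b (suc n) = ℕ→ℚ-suc-cancel n (begin
    deriv (conv A B) n
      ≡⟨ conv-deriv A B n ⟩
    conv (deriv A) B n ℚ.+ conv A (deriv B) n
      ≡⟨ cong₂ ℚ._+_ (trans (conv-congˡ B (deriv-expCoeff a) n) (conv-*ˡ a A B n))
                     (trans (conv-congʳ A (deriv-expCoeff b) n) (conv-*ʳ b A B n)) ⟩
    a ℚ.* conv A B n ℚ.+ b ℚ.* conv A B n
      ≡⟨ sym (ℚₚ.*-distribʳ-+ (conv A B n) a b) ⟩
    (a ℚ.+ b) ℚ.* conv A B n
      ≡⟨ cong ((a ℚ.+ b) ℚ.*_) (conv-expCoeff a b n) ⟩
    (a ℚ.+ b) ℚ.* expCoeff (a ℚ.+ b) n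
      ≡⟨ sym (deriv-expCoeff (a ℚ.+ b) n) ⟩
    deriv (expCoeff (a ℚ.+ b)) n ∎)
    where
    A = expCoeff a
    B = expCoeff b

-- The complex exponential on the real line

re-Σ : ∀ f a k i → seq (re (Σ[ a ,+ k ] f)) i ≡ psum (λ j → seq (re (f (a +ℕ j))) i) k
re-Σ f a zero    i = refl
re-Σ f a (suc k) i = cong (ℚ._+ seq (re (f (a +ℕ k))) i) (re-Σ f a k i)

im-Σ : ∀ f a k i → seq (im (Σ[ a ,+ k ] f)) i ≡ psum (λ j → seq (im (f (a +ℕ j))) i) k
im-Σ f a zero    i = refl
im-Σ f a (suc k) i = cong (ℚ._+ seq (im (f (a +ℕ k))) i) (im-Σ f a k i)

-- The imaginary coordinate is constantly `0`, so the approximations agree exactly at every index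
-- and not only in the limit.
pow-real : ∀ x k n →
  seq (re (pow (ℝ→ℂ x) k)) n ≡ qpow (seq x n) k × seq (im (pow (ℝ→ℂ x) k)) n ≡ 0ℚ
pow-real x zero    n = refl , refl
pow-real x (suc k) n =
  let p , q = pow-real x k n
      r = seq (re (pow (ℝ→ℂ x) k)) n
      i = seq (im (pow (ℝ→ℂ x) k)) n
  in
  trans (solve 3 (λ x r i → x :* r :+ (:- (con 0ℚ :* i)) := x :* r) refl (seq x n) r i)
        (cong (seq x n ℚ.*_) p) ,
  trans (solve 3 (λ x r i → x :* i :+ con 0ℚ :* r := x :* i) refl (seq x n) r i)
        (trans (cong (seq x n ℚ.*_) q) (ℚₚ.*-zeroʳ (seq x n)))

exp-real-re : ∀ x k n → seq (re (Σ[ 0 ,+ k ] (expTerm (ℝ→ℂ x)))) n ≡ expSum (seq x n) k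
exp-real-re x k n = trans (re-Σ (expTerm (ℝ→ℂ x)) 0 k n)
  (psum-cong (λ j → cong (1/ j ! ℚ.*_) (proj₁ (pow-real x j n))) k)

exp-real-im : ∀ x k n → seq (im (Σ[ 0 ,+ k ] (expTerm (ℝ→ℂ x)))) n ≡ 0ℚ
exp-real-im x k n = trans (im-Σ (expTerm (ℝ→ℂ x)) 0 k n) (trans
  (psum-cong (λ j → trans (cong (1/ j ! ℚ.*_) (proj₂ (pow-real x j n))) (ℚₚ.*-zeroʳ (1/ j !))) k)
  (psum-0 k))

IsCauchy-≗ : ∀ {x y} → (∀ n → x n ≡ y n) → IsCauchy x → IsCauchy y
IsCauchy-≗ h cx ε 0<ε = let N , hN = cx ε 0<ε in
  N , λ m n p q → subst₂ (λ a b → dist a b ≤ ε) (h m) (h n) (hN m n p q)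

-- For a constant sequence the diagonal that defines `exp` is just the sequence of partial sums, so
-- its Cauchy property can be reused.
expSum-cauchy : ∀ q → IsCauchy (expSum q)
expSum-cauchy q = IsCauchy-≗ {seq (re (exp (ℝ→ℂ (ℚ→ℝ q))))} {expSum q}
  (λ n → exp-real-re (ℚ→ℝ q) n n) (cauchy (re (exp (ℝ→ℂ (ℚ→ℝ q)))))

expSum-tail : ∀ q → Null (λ n → expSum q (n +ℕ n) ℚ.- expSum q n)
expSum-tail q ε 0<ε = let N , hN = expSum-cauchy q ε 0<ε in
  N , λ n p → hN (n +ℕ n) n (ℕₚ.≤-trans p (ℕₚ.m≤m+n n n)) p

expSum-bounded : ∀ q → ∃[ M ] 0ℚ < M × (∀ n → ∣ expSum q n ∣ ≤ M)
expSum-bounded q = bounded {expSum q} (expSum-cauchy q)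

-- The empty sum is `0`, so the value `1` needs at least one term; this is the source of `1 ≤ n` in
-- `expSum-inverse`.
expSum-0 : ∀ n → expSum 0ℚ (suc n) ≡ 1ℚ
expSum-0 zero    = refl
expSum-0 (suc n) = cong₂ ℚ._+_ (expSum-0 n)
  (trans (cong (1/ suc n ! ℚ.*_) (ℚₚ.*-zeroˡ (qpow 0ℚ n))) (ℚₚ.*-zeroʳ (1/ suc n !)))

∣qpow∣≤ : ∀ {q B} → ∣ q ∣ ≤ B → ∀ k → ∣ qpow q k ∣ ≤ qpow B k
∣qpow∣≤ h zero    = ℚₚ.≤-refl
∣qpow∣≤ h (suc k) = ∣p*q∣≤ h (∣qpow∣≤ h k)

∣expCoeff∣≤ : ∀ {q B} → ∣ q ∣ ≤ B → ∀ k → ∣ expCoeff q k ∣ ≤ expCoeff B k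
∣expCoeff∣≤ h k = ∣p*q∣≤ (ℚₚ.≤-reflexive (ℚₚ.0≤p⇒∣p∣≡p (1/!-nonneg k))) (∣qpow∣≤ h k)

expCoeff-nonneg : ∀ {B} → 0ℚ ≤ B → ∀ k → 0ℚ ≤ expCoeff B k
expCoeff-nonneg h k = *-nonneg (1/!-nonneg k) (qpow-nonneg h k)

-- By the Cauchy product at `x` and `- x`, the triangle `j + k < n` contributes exactly `1`, so the
-- error is the rest of the `n` by `n` square. It is dominated by the same region for the majorant
-- at `B`, whose square fits inside the triangle `j + k < n + n`.
expSum-inverse : ∀ {x B} → ∣ x ∣ ≤ B → ∀ n → 1 ≤ℕ n →
  ∣ expSum x n ℚ.* expSum (ℚ.- x) n ℚ.- 1ℚ ∣ ≤ expSum (B ℚ.+ B) (n +ℕ n) ℚ.- expSum (B ℚ.+ B) n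
expSum-inverse {x} {B} h n@(suc m) _ = begin
  ∣ expSum x n ℚ.* expSum (ℚ.- x) n ℚ.- 1ℚ ∣
    ≡⟨ cong (λ a → ∣ expSum x n ℚ.* expSum (ℚ.- x) n ℚ.- a ∣) (sym triangle) ⟩
  ∣ expSum x n ℚ.* expSum (ℚ.- x) n ℚ.- psum (conv (expCoeff x) (expCoeff (ℚ.- x))) n ∣
    -- Both offsets are `0`, which makes the rectangle a square; the left length first appears as
    -- `n + 0`.
    ≤⟨ subst (λ k → ∣ expSum x k ℚ.* expSum (ℚ.- x) n ℚ.- psum (conv (expCoeff x) (expCoeff (ℚ.- x))) n ∣
                  ≤ expSum B k ℚ.* expSum B n ℚ.- psum (conv (expCoeff B) (expCoeff B)) n)
         (ℕₚ.+-identityʳ n)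
         (product-conv-dist (∣expCoeff∣≤ h) (∣expCoeff∣≤ {ℚ.- x} (subst (_≤ B) (sym (ℚₚ.∣-p∣≡∣p∣ x)) h)) n 0 0) ⟩
  expSum B n ℚ.* expSum B n ℚ.- psum (conv (expCoeff B) (expCoeff B)) n
    ≤⟨ ℚₚ.+-monoˡ-≤ (ℚ.- psum (conv (expCoeff B) (expCoeff B)) n)
         (product≤conv (expCoeff-nonneg 0≤B) (expCoeff-nonneg 0≤B) n n) ⟩
  psum (conv (expCoeff B) (expCoeff B)) (n +ℕ n) ℚ.- psum (conv (expCoeff B) (expCoeff B)) n
    ≡⟨ cong₂ ℚ._-_ (psum-cong (conv-expCoeff B B) (n +ℕ n)) (psum-cong (conv-expCoeff B B) n) ⟩
  expSum (B ℚ.+ B) (n +ℕ n) ℚ.- expSum (B ℚ.+ B) n ∎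
  where
  open ℚₚ.≤-Reasoning
  0≤B : 0ℚ ≤ B
  0≤B = ℚₚ.≤-trans (ℚₚ.0≤∣p∣ x) h
  triangle : psum (conv (expCoeff x) (expCoeff (ℚ.- x))) n ≡ 1ℚ
  triangle = trans (psum-cong (conv-expCoeff x (ℚ.- x)) n)
    (trans (cong (λ q → expSum q n) (ℚₚ.+-inverseʳ x)) (expSum-0 m))

exp-real-inverse : ∀ x → (re (exp (ℝ→ℂ x)) *ᴿ re (exp (ℝ→ℂ (-ᴿ x)))) ≃ᴿ 1ᴿ
exp-real-inverse x = null-≗
  (λ n → cong₂ (λ a b → a ℚ.* b ℚ.- 1ℚ) (exp-real-re x n n) (exp-real-re (-ᴿ x) n n))
  -- A single `B` bounds every approximation of `x`, so the majorant series does not vary with `n`.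
  (let B , _ , hB = bounded {seq x} (cauchy x) in
   null-≤ 1 (λ n p → ℚₚ.≤-trans (expSum-inverse (hB n) n p) (p≤∣p∣ _)) (expSum-tail (B ℚ.+ B)))

-- Continuity of the exponential

-- The ℓ¹ norm of the `n`-th approximation: it stays rational, with no square root, and is still
-- submultiplicative.
norm : ℂ → ℕ → ℚ
norm z n = ∣ seq (re z) n ∣ ℚ.+ ∣ seq (im z) n ∣

null-norm : ∀ {z w} → z ≃ w → Null (norm (z - w))
null-norm {z} {w} (p , q) = null-+ (null-∣∣ {λ n → seq (re z) n ℚ.- seq (re w) n} p)
                                   (null-∣∣ {λ n → seq (im z) n ℚ.- seq (im w) n} q)

module _ where
  open ℚₚ.≤-Reasoning

  norm-nonneg : ∀ z n → 0ℚ ≤ norm z n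
  norm-nonneg z n = ℚₚ.+-mono-≤ (ℚₚ.0≤∣p∣ (seq (re z) n)) (ℚₚ.0≤∣p∣ (seq (im z) n))

  norm-+ : ∀ z w n → norm (z + w) n ≤ norm z n ℚ.+ norm w n
  norm-+ z w n = begin
    norm (z + w) n
      ≤⟨ ℚₚ.+-mono-≤ (ℚₚ.∣p+q∣≤∣p∣+∣q∣ (seq (re z) n) (seq (re w) n)) (ℚₚ.∣p+q∣≤∣p∣+∣q∣ (seq (im z) n) (seq (im w) n)) ⟩
    (a ℚ.+ c) ℚ.+ (b ℚ.+ d)
      ≡⟨ solve 4 (λ a b c d → (a :+ c) :+ (b :+ d) := (a :+ b) :+ (c :+ d)) refl a b c d ⟩
    norm z n ℚ.+ norm w n ∎
    where
    a = ∣ seq (re z) n ∣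
    b = ∣ seq (im z) n ∣
    c = ∣ seq (re w) n ∣
    d = ∣ seq (im w) n ∣

  norm-* : ∀ z w n → norm (z * w) n ≤ norm z n ℚ.* norm w n
  norm-* z w n = begin
    ∣ a ℚ.* c ℚ.- b ℚ.* d ∣ ℚ.+ ∣ a ℚ.* d ℚ.+ b ℚ.* c ∣
      ≤⟨ ℚₚ.+-mono-≤ (ℚₚ.∣p-q∣≤∣p∣+∣q∣ (a ℚ.* c) (b ℚ.* d)) (ℚₚ.∣p+q∣≤∣p∣+∣q∣ (a ℚ.* d) (b ℚ.* c)) ⟩
    (∣ a ℚ.* c ∣ ℚ.+ ∣ b ℚ.* d ∣) ℚ.+ (∣ a ℚ.* d ∣ ℚ.+ ∣ b ℚ.* c ∣)
      ≡⟨ cong₂ ℚ._+_ (cong₂ ℚ._+_ (ℚₚ.∣p*q∣≡∣p∣*∣q∣ a c) (ℚₚ.∣p*q∣≡∣p∣*∣q∣ b d))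
                     (cong₂ ℚ._+_ (ℚₚ.∣p*q∣≡∣p∣*∣q∣ a d) (ℚₚ.∣p*q∣≡∣p∣*∣q∣ b c)) ⟩
    (∣ a ∣ ℚ.* ∣ c ∣ ℚ.+ ∣ b ∣ ℚ.* ∣ d ∣) ℚ.+ (∣ a ∣ ℚ.* ∣ d ∣ ℚ.+ ∣ b ∣ ℚ.* ∣ c ∣)
      ≡⟨ solve 4 (λ a b c d → (a :* c :+ b :* d) :+ (a :* d :+ b :* c) := (a :+ b) :* (c :+ d)) refl
           (∣ a ∣) (∣ b ∣) (∣ c ∣) (∣ d ∣) ⟩
    norm z n ℚ.* norm w n ∎
    where
    a = seq (re z) n
    b = seq (im z) n
    c = seq (re w) n
    d = seq (im w) n

  norm-pow : ∀ z n {B} → norm z n ≤ B → ∀ k → norm (pow z k) n ≤ qpow B k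
  norm-pow z n {B} h zero    = ℚₚ.≤-refl
  norm-pow z n {B} h (suc k) = begin
    norm (z * pow z k) n            ≤⟨ norm-* z (pow z k) n ⟩
    norm z n ℚ.* norm (pow z k) n   ≤⟨ *-mono-≤ (norm-nonneg z n) (ℚₚ.≤-trans (norm-nonneg (pow z k) n) (norm-pow z n h k)) h (norm-pow z n h k) ⟩
    B ℚ.* qpow B k                  ∎

  qpow-mono : ∀ {a b} → 0ℚ ≤ a → a ≤ b → ∀ k → qpow a k ≤ qpow b k
  qpow-mono 0≤a a≤b zero    = ℚₚ.≤-refl
  qpow-mono 0≤a a≤b (suc k) = *-mono-≤ 0≤a (qpow-nonneg (ℚₚ.≤-trans 0≤a a≤b) k) a≤b (qpow-mono 0≤a a≤b k)

  module _ (z w : ℂ) (n : ℕ) {B : ℚ} (hz : norm z n ≤ B) (hw : norm w n ≤ B) where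
    private
      δ = norm (z - w) n
      0≤B : 0ℚ ≤ B
      0≤B = ℚₚ.≤-trans (norm-nonneg z n) hz

    -- The base `B + 1` absorbs both summands of the product rule, since B δ Q + δ Q = δ (B + 1) Q.
    -- This replaces the sharper bound δ k Bᵏ⁻¹ by a pure power, which sums to an exponential
    -- series.
    norm-pow-diff : ∀ k → norm (pow z k - pow w k) n ≤ δ ℚ.* qpow (B ℚ.+ 1ℚ) k
    norm-pow-diff zero    = ℚₚ.≤-trans (norm-nonneg (z - w) n) (ℚₚ.≤-reflexive (sym (ℚₚ.*-identityʳ δ)))
    norm-pow-diff (suc k) = begin
      norm (z * p - w * q) n
        -- The identity z p - w q = z (p - q) + (z - w) q, verified in each coordinate.
        ≡⟨ cong₂ (λ x y → ∣ x ∣ ℚ.+ ∣ y ∣)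
             (trans
               (solve 4 (λ x y u v → (x :- y) :- (u :- v) := (x :- u) :- (y :- v)) refl
                  (a ℚ.* e) (b ℚ.* f) (c ℚ.* g) (d ℚ.* h))
               (trans (cong₂ ℚ._-_ (diff a c e g) (diff b d f h))
                 (solve 4 (λ x y u v → (x :+ y) :- (u :+ v) := (x :- u) :+ (y :- v)) refl
                    (a ℚ.* (e ℚ.- g)) ((a ℚ.- c) ℚ.* g) (b ℚ.* (f ℚ.- h)) ((b ℚ.- d) ℚ.* h))))
             (trans
               (solve 4 (λ x y u v → (x :+ y) :- (u :+ v) := (x :- u) :+ (y :- v)) refl
                  (a ℚ.* f) (b ℚ.* e) (c ℚ.* h) (d ℚ.* g))
               (trans (cong₂ ℚ._+_ (diff a c f h) (diff b d e g))
                 (solve 4 (λ x y u v → (x :+ y) :+ (u :+ v) := (x :+ u) :+ (y :+ v)) refl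
                    (a ℚ.* (f ℚ.- h)) ((a ℚ.- c) ℚ.* h) (b ℚ.* (e ℚ.- g)) ((b ℚ.- d) ℚ.* g)))) ⟩
      norm (z * (p - q) + (z - w) * q) n
        ≤⟨ norm-+ (z * (p - q)) ((z - w) * q) n ⟩
      norm (z * (p - q)) n ℚ.+ norm ((z - w) * q) n
        ≤⟨ ℚₚ.+-mono-≤ (norm-* z (p - q) n) (norm-* (z - w) q n) ⟩
      norm z n ℚ.* norm (p - q) n ℚ.+ δ ℚ.* norm q n
        ≤⟨ ℚₚ.+-mono-≤
             (*-mono-≤ (norm-nonneg z n) (*-nonneg (norm-nonneg (z - w) n) (qpow-nonneg 0≤B+1 k)) hz (norm-pow-diff k))
             (ℚₚ.*-monoˡ-≤-nonNeg δ {{ℚ.nonNegative (norm-nonneg (z - w) n)}}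
               (ℚₚ.≤-trans (norm-pow w n hw k) (qpow-mono 0≤B B≤B+1 k))) ⟩
      B ℚ.* (δ ℚ.* Q) ℚ.+ δ ℚ.* Q
        ≡⟨ solve 3 (λ B δ Q → B :* (δ :* Q) :+ δ :* Q := δ :* ((B :+ con 1ℚ) :* Q)) refl B δ Q ⟩
      δ ℚ.* qpow (B ℚ.+ 1ℚ) (suc k) ∎
      where
      p = pow z k
      q = pow w k
      Q = qpow (B ℚ.+ 1ℚ) k
      a = seq (re z) n
      b = seq (im z) n
      c = seq (re w) n
      d = seq (im w) n
      e = seq (re p) n
      f = seq (im p) n
      g = seq (re q) n
      h = seq (im q) n
      diff : ∀ x x′ y y′ → x ℚ.* y ℚ.- x′ ℚ.* y′ ≡ x ℚ.* (y ℚ.- y′) ℚ.+ (x ℚ.- x′) ℚ.* y′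
      diff = solve 4 (λ x x′ y y′ → x :* y :- x′ :* y′ := x :* (y :- y′) :+ (x :- x′) :* y′) refl
      B≤B+1 : B ≤ B ℚ.+ 1ℚ
      B≤B+1 = ℚₚ.≤-trans (ℚₚ.≤-reflexive (sym (ℚₚ.+-identityʳ B))) (ℚₚ.+-monoʳ-≤ B (ℚₚ.<⇒≤ (ℚₚ.positive⁻¹ 1ℚ)))
      0≤B+1 = ℚₚ.≤-trans 0≤B B≤B+1

    norm-expTerm-diff : ∀ k → norm (expTerm z k - expTerm w k) n ≤ δ ℚ.* expCoeff (B ℚ.+ 1ℚ) k
    norm-expTerm-diff k = begin
      norm (expTerm z k - expTerm w k) n
        ≡⟨ cong₂ (λ x y → ∣ x ∣ ℚ.+ ∣ y ∣) (factor (seq (re p) n) (seq (re q) n)) (factor (seq (im p) n) (seq (im q) n)) ⟩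
      ∣ c ℚ.* seq (re (p - q)) n ∣ ℚ.+ ∣ c ℚ.* seq (im (p - q)) n ∣
        ≡⟨ cong₂ ℚ._+_ (abs (seq (re (p - q)) n)) (abs (seq (im (p - q)) n)) ⟩
      c ℚ.* ∣ seq (re (p - q)) n ∣ ℚ.+ c ℚ.* ∣ seq (im (p - q)) n ∣
        ≡⟨ sym (ℚₚ.*-distribˡ-+ c _ _) ⟩
      c ℚ.* norm (p - q) n
        ≤⟨ ℚₚ.*-monoˡ-≤-nonNeg c {{ℚ.nonNegative (1/!-nonneg k)}} (norm-pow-diff k) ⟩
      c ℚ.* (δ ℚ.* qpow (B ℚ.+ 1ℚ) k)
        ≡⟨ solve 3 (λ c δ Q → c :* (δ :* Q) := δ :* (c :* Q)) refl c δ (qpow (B ℚ.+ 1ℚ) k) ⟩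
      δ ℚ.* expCoeff (B ℚ.+ 1ℚ) k ∎
      where
      p = pow z k
      q = pow w k
      c = 1/ k !
      factor : ∀ x y → c ℚ.* x ℚ.- c ℚ.* y ≡ c ℚ.* (x ℚ.- y)
      factor = solve 3 (λ c x y → c :* x :- c :* y := c :* (x :- y)) refl c
      abs : ∀ x → ∣ c ℚ.* x ∣ ≡ c ℚ.* ∣ x ∣
      abs x = trans (ℚₚ.∣p*q∣≡∣p∣*∣q∣ c x) (cong (ℚ._* ∣ x ∣) (ℚₚ.0≤p⇒∣p∣≡p (1/!-nonneg k)))

    -- The Lipschitz constant is itself a partial sum of a convergent series, hence bounded in `k`.
    norm-expSum-diff : ∀ k → norm (Σ[ 0 ,+ k ] (expTerm z) - Σ[ 0 ,+ k ] (expTerm w)) n ≤ δ ℚ.* expSum (B ℚ.+ 1ℚ) k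
    norm-expSum-diff zero    = ℚₚ.≤-reflexive (sym (ℚₚ.*-zeroʳ δ))
    norm-expSum-diff (suc k) = begin
      norm ((S + s) - (T + t)) n
        ≡⟨ cong₂ (λ x y → ∣ x ∣ ℚ.+ ∣ y ∣)
             (swap (seq (re S) n) (seq (re s) n) (seq (re T) n) (seq (re t) n))
             (swap (seq (im S) n) (seq (im s) n) (seq (im T) n) (seq (im t) n)) ⟩
      norm ((S - T) + (s - t)) n
        ≤⟨ norm-+ (S - T) (s - t) n ⟩
      norm (S - T) n ℚ.+ norm (s - t) n
        ≤⟨ ℚₚ.+-mono-≤ (norm-expSum-diff k) (norm-expTerm-diff k) ⟩
      δ ℚ.* expSum (B ℚ.+ 1ℚ) k ℚ.+ δ ℚ.* expCoeff (B ℚ.+ 1ℚ) k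
        ≡⟨ sym (ℚₚ.*-distribˡ-+ δ (expSum (B ℚ.+ 1ℚ) k) (expCoeff (B ℚ.+ 1ℚ) k)) ⟩
      δ ℚ.* expSum (B ℚ.+ 1ℚ) (suc k) ∎
      where
      S = Σ[ 0 ,+ k ] (expTerm z)
      T = Σ[ 0 ,+ k ] (expTerm w)
      s = expTerm z k
      t = expTerm w k
      swap : ∀ a b c d → (a ℚ.+ b) ℚ.- (c ℚ.+ d) ≡ (a ℚ.- c) ℚ.+ (b ℚ.- d)
      swap = solve 4 (λ a b c d → (a :+ b) :- (c :+ d) := (a :- c) :+ (b :- d)) refl

  norm-bounded : ∀ z → ∃[ B ] ∀ n → norm z n ≤ B
  norm-bounded z with bounded {seq (re z)} (cauchy (re z)) | bounded {seq (im z)} (cauchy (im z))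
  ... | B , _ , hB | C , _ , hC = B ℚ.+ C , λ n → ℚₚ.+-mono-≤ (hB n) (hC n)

  ∣re∣≤norm : ∀ u n → ∣ seq (re u) n ∣ ≤ norm u n
  ∣re∣≤norm u n = ℚₚ.≤-trans (ℚₚ.≤-reflexive (sym (ℚₚ.+-identityʳ _)))
    (ℚₚ.+-monoʳ-≤ ∣ seq (re u) n ∣ (ℚₚ.0≤∣p∣ (seq (im u) n)))

  ∣im∣≤norm : ∀ u n → ∣ seq (im u) n ∣ ≤ norm u n
  ∣im∣≤norm u n = ℚₚ.≤-trans (ℚₚ.≤-reflexive (sym (ℚₚ.+-identityˡ _)))
    (ℚₚ.+-monoˡ-≤ ∣ seq (im u) n ∣ (ℚₚ.0≤∣p∣ (seq (re u) n)))

  -- Here `n` is both the number of terms and the index of approximation, as on the diagonal that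
  -- defines `exp`. The difference is at most the bounded factor `E n` times the null sequence
  -- `norm (z - w) n`.
  null-expSum-diff : ∀ {z w} → z ≃ w →
    Null (λ n → norm (Σ[ 0 ,+ n ] (expTerm z) - Σ[ 0 ,+ n ] (expTerm w)) n)
  null-expSum-diff {z} {w} z≃w =
    let B₁ , h₁ = norm-bounded z
        B₂ , h₂ = norm-bounded w
        E = expSum ((B₁ ℚ.⊔ B₂) ℚ.+ 1ℚ)
        M , 0<M , hM = expSum-bounded ((B₁ ℚ.⊔ B₂) ℚ.+ 1ℚ)
    in null-≤ 0 (λ n _ → begin
      ∣ norm (Σ[ 0 ,+ n ] (expTerm z) - Σ[ 0 ,+ n ] (expTerm w)) n ∣
        ≡⟨ ℚₚ.0≤p⇒∣p∣≡p (norm-nonneg (Σ[ 0 ,+ n ] (expTerm z) - Σ[ 0 ,+ n ] (expTerm w)) n) ⟩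
      norm (Σ[ 0 ,+ n ] (expTerm z) - Σ[ 0 ,+ n ] (expTerm w)) n
        ≤⟨ norm-expSum-diff z w n (ℚₚ.≤-trans (h₁ n) (ℚₚ.p≤p⊔q B₁ B₂)) (ℚₚ.≤-trans (h₂ n) (ℚₚ.p≤q⊔p B₁ B₂)) n ⟩
      norm (z - w) n ℚ.* E n     ≡⟨ ℚₚ.*-comm (norm (z - w) n) (E n) ⟩
      E n ℚ.* norm (z - w) n     ≤⟨ p≤∣p∣ _ ⟩
      ∣ E n ℚ.* norm (z - w) n ∣ ∎)
      (null-* E M 0<M hM (null-norm {z} {w} z≃w))

exp-cong : ∀ {z w} → z ≃ w → exp z ≃ exp w
exp-cong {z} {w} z≃w = re≃ , im≃
  where
  D : ℕ → ℂ
  D n = Σ[ 0 ,+ n ] (expTerm z) - Σ[ 0 ,+ n ] (expTerm w)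
  re≃ : re (exp z) ≃ᴿ re (exp w)
  re≃ = null-≤ {λ n → seq (re (D n)) n} {λ n → norm (D n) n} 0
    (λ n _ → ℚₚ.≤-trans (∣re∣≤norm (D n) n) (p≤∣p∣ (norm (D n) n)))
    (null-expSum-diff {z} {w} z≃w)
  im≃ : im (exp z) ≃ᴿ im (exp w)
  im≃ = null-≤ {λ n → seq (im (D n)) n} {λ n → norm (D n) n} 0
    (λ n _ → ℚₚ.≤-trans (∣im∣≤norm (D n) n) (p≤∣p∣ (norm (D n) n)))
    (null-expSum-diff {z} {w} z≃w)

-- Cancelling the exponent and inverting the exponential

-- `recip⊔` clamps `∣ z ∣²` from below at `c`, so `r` is its true inverse only from index `N` on,
-- and the real parts agree from there. The imaginary part vanishes at every index, because the
-- product of `z` with its conjugate is real.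
recip-cancel : ∀ z (z#0 : z #0) x → recip z z#0 * (- (z * ℝ→ℂ x)) ≃ ℝ→ℂ (-ᴿ x)
recip-cancel z z#0@(c , 0<c , N , h) x =
    ≃ᴿ-eventually {re (recip z z#0 * (- (z * ℝ→ℂ x)))} { -ᴿ x} N (λ n p → trans
      (solve 4 (λ a b r x →
         (a :* r) :* (:- (a :* x :- b :* con 0ℚ)) :- (:- (b :* r)) :* (:- (a :* con 0ℚ :+ b :* x))
         := (r :* (a :* a :+ b :* b)) :* (:- x)) refl
         (seq (re z) n) (seq (im z) n) (r n) (seq x n))
      (trans (cong (ℚ._* (ℚ.- seq x n)) (inverse n p)) (ℚₚ.*-identityˡ (ℚ.- seq x n))))
  , ≃ᴿ-pointwise {im (recip z z#0 * (- (z * ℝ→ℂ x)))} {0ᴿ} (λ n →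
      solve 4 (λ a b r x →
         (a :* r) :* (:- (a :* con 0ℚ :+ b :* x)) :+ (:- (b :* r)) :* (:- (a :* x :- b :* con 0ℚ))
         := con 0ℚ) refl
         (seq (re z) n) (seq (im z) n) (r n) (seq x n))
  where
  r : ℕ → ℚ
  r n = Cauchy-Lemmas.recip⊔ 0<c (seq ∣ z ∣² n)
  inverse : ∀ n → N ≤ℕ n → r n ℚ.* seq ∣ z ∣² n ≡ 1ℚ
  inverse n p = trans
    (cong (r n ℚ.*_) (sym (ℚₚ.p≤q⇒p⊔q≡q (subst (_≤ seq ∣ z ∣² n) (ℚₚ.+-identityˡ c) (h n p)))))
    (ℚₚ.*-inverseˡ (c ℚ.⊔ seq ∣ z ∣² n) {{ℚ.>-nonZero (Cauchy-Lemmas.⊔-pos 0<c (seq ∣ z ∣² n))}})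

-- With `y` the value at `- x`, y = q (y m) and y m = y e = 1, where `e ≃ᴿ m` is the hypothesis on
-- `x`.
exp-neg-log : ∀ n x → exp (ℝ→ℂ x) ≃ ℕ→ℂ (suc n) → exp (ℝ→ℂ (-ᴿ x)) ≃ ℚ→ℂ (1/suc n)
exp-neg-log n x (e≃ , _) =
    ≃ᴿ-trans {y} {ℚ→ℝ q *ᴿ (y *ᴿ m)} {ℚ→ℝ q}
      (≃ᴿ-pointwise {y} {ℚ→ℝ q *ᴿ (y *ᴿ m)} (λ k → sym (trans
        (solve 3 (λ q y m → q :* (y :* m) := (q :* m) :* y) refl q (seq y k) (ℕ→ℚ (suc n)))
        (trans (cong (ℚ._* seq y k) (1/suc-inverse n)) (ℚₚ.*-identityˡ (seq y k))))))
    (≃ᴿ-trans {ℚ→ℝ q *ᴿ (y *ᴿ m)} {ℚ→ℝ q *ᴿ 1ᴿ} {ℚ→ℝ q}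
      (*ᴿ-congˡ {ℚ→ℝ q} {y *ᴿ m} {1ᴿ} ym≃1)
      (≃ᴿ-pointwise {ℚ→ℝ q *ᴿ 1ᴿ} {ℚ→ℝ q} (λ _ → ℚₚ.*-identityʳ q)))
  , ≃ᴿ-pointwise {im (exp (ℝ→ℂ (-ᴿ x)))} {0ᴿ} (λ k → exp-real-im (-ᴿ x) k k)
  where
  q = 1/suc n
  m = ℚ→ℝ (ℕ→ℚ (suc n))
  e = re (exp (ℝ→ℂ x))
  y = re (exp (ℝ→ℂ (-ᴿ x)))
  ym≃1 : (y *ᴿ m) ≃ᴿ 1ᴿ
  ym≃1 = ≃ᴿ-trans {y *ᴿ m} {y *ᴿ e} {1ᴿ}
    (*ᴿ-congˡ {y} {m} {e} (≃ᴿ-sym {e} {m} e≃))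
    (≃ᴿ-trans {y *ᴿ e} {e *ᴿ y} {1ᴿ}
      (≃ᴿ-pointwise {y *ᴿ e} {e *ᴿ y} (λ k → ℚₚ.*-comm (seq y k) (seq e k)))
      (exp-real-inverse x))

-- Tails of convergent series

swap-offset : ∀ n a j → n +ℕ a +ℕ j ≡ a +ℕ (n +ℕ j)
swap-offset n a j = trans (cong (_+ℕ j) (ℕₚ.+-comm n a)) (ℕₚ.+-assoc a n j)

re-Σ-split : ∀ f a n k i → seq (re (Σ[ a ,+ k +ℕ n ] f)) i ≡
  seq (re (Σ[ a ,+ n ] f)) i ℚ.+ seq (re (Σ[ n +ℕ a ,+ k ] f)) i
re-Σ-split f a n k i = trans (re-Σ f a (k +ℕ n) i) (trans (psum-split u n k) (sym (cong₂ ℚ._+_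
  (re-Σ f a n i)
  (trans (re-Σ f (n +ℕ a) k i) (psum-cong (λ j → cong (λ m → seq (re (f m)) i) (swap-offset n a j)) k)))))
  where
  u : ℕ → ℚ
  u j = seq (re (f (a +ℕ j))) i

im-Σ-split : ∀ f a n k i → seq (im (Σ[ a ,+ k +ℕ n ] f)) i ≡
  seq (im (Σ[ a ,+ n ] f)) i ℚ.+ seq (im (Σ[ n +ℕ a ,+ k ] f)) i
im-Σ-split f a n k i = trans (im-Σ f a (k +ℕ n) i) (trans (psum-split u n k) (sym (cong₂ ℚ._+_
  (im-Σ f a n i)
  (trans (im-Σ f (n +ℕ a) k i) (psum-cong (λ j → cong (λ m → seq (im (f m)) i) (swap-offset n a j)) k)))))
  where
  u : ℕ → ℚ
  u j = seq (im (f (a +ℕ j))) i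

-- `S (k + n) − z` and `T k − (z − c)` are equal at every index, so the threshold for `S` also
-- serves `T`.
⟶ᴿ-drop : ∀ {S T : ℕ → ℝ} {z c : ℝ} n →
  (∀ k i → seq (S (k +ℕ n)) i ≡ seq c i ℚ.+ seq (T k) i) → S ⟶ᴿ z → T ⟶ᴿ (z -ᴿ c)
⟶ᴿ-drop {S} {T} {z} {c} n split S⟶z ε 0<ε with S⟶z ε 0<ε
... | K , hK = K , λ k K≤k →
  let below , above = hK (k +ℕ n) (ℕₚ.≤-trans K≤k (ℕₚ.m≤m+n k n)) in
  (λ η 0<η → let N , hN = below η 0<η in N , λ i p → subst (_≤ ε ℚ.+ η) (trans
    (cong (ℚ._- seq z i) (split k i))
    (solve 3 (λ c t z → (c :+ t) :- z := t :- (z :- c)) refl (seq c i) (seq (T k) i) (seq z i))) (hN i p)) ,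
  (λ η 0<η → let N , hN = above η 0<η in N , λ i p → subst (_≤ ε ℚ.+ η) (trans
    (cong (λ x → seq z i ℚ.- x) (split k i))
    (solve 3 (λ c t z → z :- (c :+ t) := (z :- c) :- t) refl (seq c i) (seq (T k) i) (seq z i))) (hN i p))

series-tail : ∀ f a {z} n → Σ[ a ,∞] f ⇓ z → Σ[ n +ℕ a ,∞] f ⇓ (z - Σ[ a ,+ n ] f)
series-tail f a {z} n (r , i) =
    ⟶ᴿ-drop {λ k → re (Σ[ a ,+ k ] f)} {λ k → re (Σ[ n +ℕ a ,+ k ] f)} {re z} {re (Σ[ a ,+ n ] f)} n
      (re-Σ-split f a n) r
  , ⟶ᴿ-drop {λ k → im (Σ[ a ,+ k ] f)} {λ k → im (Σ[ n +ℕ a ,+ k ] f)} {im z} {im (Σ[ a ,+ n ] f)} n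
      (im-Σ-split f a n) i

-- The remaining term and the Catalan number

-- A sum of `suc n` terms starting at `1` ends with `f (suc n)`; everything else cancels index by
-- index.
remaining-term : ∀ f n z → f (suc n) ≃ z - Σ[ 1 ,+ n ] f - (z - Σ[ 1 ,+ suc n ] f)
remaining-term f n z =
    ≃ᴿ-pointwise {re (f (suc n))} {re (z - Σ[ 1 ,+ n ] f - (z - Σ[ 1 ,+ suc n ] f))}
      (λ i → cancel (seq (re z) i) (seq (re (Σ[ 1 ,+ n ] f)) i) (seq (re (f (suc n))) i))
  , ≃ᴿ-pointwise {im (f (suc n))} {im (z - Σ[ 1 ,+ n ] f - (z - Σ[ 1 ,+ suc n ] f))}
      (λ i → cancel (seq (im z) i) (seq (im (Σ[ 1 ,+ n ] f)) i) (seq (im (f (suc n))) i))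
  where
  cancel : ∀ z S t → t ≡ (z ℚ.- S) ℚ.- (z ℚ.- (S ℚ.+ t))
  cancel = solve 3 (λ z S t → t := (z :- S) :- (z :- (S :+ t))) refl

·-cong : ∀ q {z w} → z ≃ w → q · z ≃ q · w
·-cong q {z} {w} (p , p′) =
  *ᴿ-congˡ {ℚ→ℝ q} {re z} {re w} p , *ᴿ-congˡ {ℚ→ℝ q} {im z} {im w} p′

·-ℚ→ℂ : ∀ p q → ℚ→ℂ (p ℚ.* q) ≃ q · ℚ→ℂ p
·-ℚ→ℂ p q =
    ≃ᴿ-pointwise {ℚ→ℝ (p ℚ.* q)} {ℚ→ℝ q *ᴿ ℚ→ℝ p} (λ _ → ℚₚ.*-comm p q)
  , ≃ᴿ-pointwise {0ᴿ} {ℚ→ℝ q *ᴿ 0ᴿ} (λ _ → sym (ℚₚ.*-zeroʳ q))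

catalan-formula : ∀ n s (s#0 : s #0) x → exp (ℝ→ℂ x) ≃ ℕ→ℂ (suc n) →
  ℚ→ℂ (catalan n) ≃ centralBinomial n · exp (recip s s#0 * (- (s * ℝ→ℂ x)))
catalan-formula n s s#0 x exp-x≃ =
  ≃-trans {ℚ→ℂ (catalan n)} {b · q} {b · p} (·-ℚ→ℂ (1/suc n) b)
    (·-cong b {q} {p} (≃-sym {p} {q} (≃-trans {p} {exp (ℝ→ℂ (-ᴿ x))} {q}
      (exp-cong {recip s s#0 * (- (s * ℝ→ℂ x))} {ℝ→ℂ (-ᴿ x)} (recip-cancel s s#0 x))
      (exp-neg-log n x exp-x≃))))
  where
  b = centralBinomial n
  q = ℚ→ℂ (1/suc n)
  p = exp (recip s s#0 * (- (s * ℝ→ℂ x)))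

proposition2 :
    (n : ℕ) → 1 ≤ℕ n →
    (s : ℂ) (σ>1 : 1ᴿ <ᴿ re s) →
    (log : ℕ → ℝ) → IsLog log →
    (ζs : ℂ) → Σ[ 1 ,∞] (λ i → 1/ i ^ s via log) ⇓ ζs →
    ∃[ tail ] (Σ[ n +ℕ 2 ,∞] (λ i → 1/ i ^ s via log) ⇓ tail) ×
      (let base = ζs - Σ[ 1 ,+ n ] (λ i → 1/ i ^ s via log) - tail
           1/s  = recip s (re>1⇒#0 s σ>1)
       in
         (∃[ p ] IsPower base 1/s p ×
            ℚ→ℂ (catalan n) ≃ centralBinomial n · p) ×
         (InPrincipalStrip (im (- (s * ℝ→ℂ (log (suc n))))) →
            ∃[ p ] IsPrincipalPower base 1/s p ×
              ℚ→ℂ (catalan n) ≃ centralBinomial n · p))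
proposition2 n _ s σ>1 log isLog ζs ζs-sum =
  let f    = λ i → 1/ i ^ s via log
      -- A series starting at `n + 2` omits the first `n + 1` terms.
      tail = ζs - Σ[ 1 ,+ suc n ] f
      -- `exp ℓ` is by definition the term `f (suc n)`, so `base≃` already says that `ℓ` is a
      -- logarithm of the base.
      ℓ    = - (s * ℝ→ℂ (log (suc n)))
      s#0  = re>1⇒#0 s σ>1
      p    = exp (recip s s#0 * ℓ)
      base≃    = remaining-term f n ζs
      catalan≃ = catalan-formula n s s#0 (log (suc n)) (isLog (suc n) (ℕ.s≤s ℕ.z≤n))
  in  tail
    -- `series-tail` starts the tail at `suc n + 1`, which is rewritten to `n + 2`.
    , subst (λ a → Σ[ a ,∞] f ⇓ tail) (sym (ℕₚ.+-suc n 1)) (series-tail f 1 {ζs} (suc n) ζs-sum)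
    , (p , (ℓ , base≃ , ≃-refl {p}) , catalan≃)
    -- The same `ℓ` and `p` work, as `strip` is exactly the condition that makes `ℓ` the principal
    -- logarithm.
    , λ strip → p , (ℓ , base≃ , strip , ≃-refl {p}) , catalan≃
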